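{- Let $n \ge k \ge r \ge 2$ be integers, and define \[ c_{k,r} \coloneqq \begin{cases} \frac{k-r+1}{k+2}, & \text{if } k < \frac{4r-2}{3},\\[2pt] \frac{3k-3r+1}{3k-2}, & \text{if } k \ge \frac{4r-2}{3}.\end{cases} \] Suppose that $\mathcal{H}$ is a $k$-partite $r$-graph on $n$ vertices with no isolated vertices and $\delta_{r-1}^{+}(\mathcal{H}) > c_{k,r}\, n$. Then $\mathcal{H}$ is uniquely $k$-colorable. Moreover, both constants $\frac{k-r+1}{k+2}$ and $\frac{3k-3r+1}{3k-2}$ are optimal, i.e., in each of the two ranges of $k$, for every real $c < c_{k,r}$ there exist $n \ge k$ and an $n$-vertex $k$-partite $r$-graph without isolated vertices with $\delta_{r-1}^{+}(\mathcal{H}) > c\, n$ that is not uniquely $k$-colorable.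
   Context: An $r$-graph $\mathcal{H}$ is a collection of $r$-element subsets (edges) of a finite vertex set $V(\mathcal{H})$; a vertex is isolated if it lies in no edge. The shadow $\partial\mathcal{H}$ is the set of $(r-1)$-subsets of $V(\mathcal{H})$ contained in some edge. For an $(r-1)$-set $S$, $d_{\mathcal{H}}(S)$ is the number of vertices $v$ with $S\cup\{v\}\in\mathcal{H}$. The minimum positive codegree is $\delta^{+}_{r-1}(\mathcal{H}) = \min\{d_{\mathcal{H}}(S) : S \in \partial\mathcal{H}\}$. A $k$-coloring of $\mathcal{H}$ is a map $\varphi: V(\mathcal{H})\to[k]$ that is injective on every edge (equivalently a homomorphism to the complete $r$-graph $K_k^r$ on $[k]$); $\mathcal{H}$ is $k$-partite ($k$-colorable) if it has a $k$-coloring. Two $k$-colorings $\varphi,\vartheta$ are equivalent if $\vartheta=\eta\circ\varphi$ for some permutation $\eta$ of $[k]$. $\mathcal{H}$ is uniquely $k$-colorable if it is $k$-colorable and any two of its $k$-colorings are equivalent. -}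

module Defs where

open import Data.Nat using (ℕ; zero; suc; _*_; _∸_; _≤_)
import Data.Nat as ℕ
open import Data.Integer using (ℤ; +_)
import Data.Integer as ℤ
open import Data.Rational using (ℚ; _/_; _<_; _*_)
open import Data.Rational.Properties using (_<?_)
open import Data.Bool using (Bool; true; false; not; _∧_; if_then_else_)
open import Data.Fin using (Fin)
open import Data.Fin.Subset using (Subset; _∈_; _∉_; _⊆_; _∪_; ⁅_⁆; ∣_∣)
open import Data.Fin.Permutation using (Permutation′; _⟨$⟩ʳ_)
open import Data.Vec using (tabulate; lookup)
open import Data.Product using (Σ; _×_; ∃; ∃-syntax; _,_)
open import Relation.Binary.PropositionalEquality using (_≡_)
open import Relation.Nullary using (¬_; does)

record RGraph (n r : ℕ) : Set where
  field
    edge    : Subset n → Bool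
    uniform : ∀ e → edge e ≡ true → ∣ e ∣ ≡ r
open RGraph public

IsEdge : ∀ {n r} → RGraph n r → Subset n → Set
IsEdge H e = edge H e ≡ true

NoIsolated : ∀ {n r} → RGraph n r → Set
NoIsolated {n} H = ∀ (v : Fin n) → ∃[ e ] (IsEdge H e × v ∈ e)

InShadow : ∀ {n r} → RGraph n r → Subset n → Set
InShadow {n} {r} H S = ∣ S ∣ ≡ r ∸ 1 × ∃[ e ] (IsEdge H e × S ⊆ e)

codeg : ∀ {n r} → RGraph n r → Subset n → ℕ
codeg H S = ∣ tabulate (λ v → not (lookup S v) ∧ edge H (S ∪ ⁅ v ⁆)) ∣

ℕ→ℚ : ℕ → ℚ
ℕ→ℚ m = (+ m) / 1

-- δ⁺_{r-1}(H) > x, i.e. min { d_H(S) : S ∈ ∂H } > x, i.e. every S in the shadow has d_H(S) > x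
MinPosCodegGreater : ∀ {n r} → RGraph n r → ℚ → Set
MinPosCodegGreater {n} H x = ∀ (S : Subset n) → InShadow H S → x < ℕ→ℚ (codeg H S)

IsColoring : ∀ {n r} (k : ℕ) → RGraph n r → (Fin n → Fin k) → Set
IsColoring {n} k H φ = ∀ e → IsEdge H e → ∀ (u v : Fin n) → u ∈ e → v ∈ e → φ u ≡ φ v → u ≡ v

Partite : ∀ {n r} (k : ℕ) → RGraph n r → Set
Partite {n} k H = ∃[ φ ] IsColoring k H φ

Equivalent : ∀ {n k} → (Fin n → Fin k) → (Fin n → Fin k) → Set
Equivalent {n} {k} φ ϑ = Σ (Permutation′ k) (λ η → ∀ (v : Fin n) → ϑ v ≡ (η ⟨$⟩ʳ φ v))

UniquelyColorable : ∀ {n r} (k : ℕ) → RGraph n r → Set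
UniquelyColorable {n} k H =
  Partite k H × (∀ (φ ϑ : Fin n → Fin k) → IsColoring k H φ → IsColoring k H ϑ → Equivalent φ ϑ)

-- The constant c_{k,r}.  Denominator 3k-2 is written suc (3k ∸ 3), which equals
-- 3k-2 whenever k ≥ 1 (always the case here since k ≥ 2).
c : ℕ → ℕ → ℚ
c k r =
  if does (ℕ→ℚ k <? ((+ (4 ℕ.* r) ℤ.- + 2) / 3))
  then (+ k ℤ.- + r ℤ.+ + 1) / (suc (suc k))
  else (+ (3 ℕ.* k) ℤ.- + (3 ℕ.* r) ℤ.+ + 1) / (suc (3 ℕ.* k ∸ 3))

{-# OPTIONS --safe #-}
module Submission where

-- Suppose φ u = φ v but ϑ u ≠ ϑ v for two k-colourings.  Write d = k − r, δ for the minimum positive codegree and N for the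
-- number of vertices; δ ≤ c N is proved by induction on d and r for complexes of faces containing u and v.  If no vertex w
-- is adjacent to both u and v, their neighbourhoods are disjoint, and since they are (k − 1)-partite with the same codegree
-- they are large.  Otherwise compare two complexes for such a w, with Y neighbours: the link of w has parameters (d, r − 1),
-- and the restriction to the neighbours of w has parameters (d − 1, r) and codegree at least δ − (N − Y).  Eliminating Y
-- from the two bounds gives the claim, except just below the point r = 3 d + 2 where the two ranges meet; there the same
-- comparison is made for up to four mutually adjacent vertices w, of which one is omitted at a time.
-- For sharpness take k − 2 ordinary classes, of one or three vertices each, and four special vertices carrying two disjoint
-- edges; the edges of the r-graph are the cliques.
open import Defs

open import Data.Bool using (Bool; true; false; not; _∧_; if_then_else_)
open import Data.Bool.Properties using (∨-idem) renaming (_≟_ to _≟ᵇ_)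
open import Data.Empty using (⊥; ⊥-elim)
open import Data.Fin using (Fin; zero; suc)
open import Data.Fin.Patterns using (0F; 1F; 2F; 3F)
open import Data.Fin.Permutation using (_⟨$⟩ʳ_; _⟨$⟩ˡ_; inverseˡ; _∘ₚ_; transpose) renaming (id to idₚ)
open import Data.Fin.Permutation.Components using () renaming (transpose to swap-values)
open import Data.Fin.Properties using (any?; all?) renaming (_≟_ to _≟ᶠ_)
open import Data.Fin.Subset using (Subset; inside; outside; ∣_∣; ⁅_⁆; _∪_; _⊆_; _∈_; _∉_) renaming (⊥ to ∅)
open import Data.Fin.Subset.Properties using (anySubset?; _∈?_; x∈⁅x⁆; x∈⁅y⁆⇒x≡y; p⊆p∪q; q⊆p∪q; x∈p∪q⁻; ∪-identityʳ; ∉⊥; ∣⊥∣≡0; ∣⁅x⁆∣≡1; drop-∷-⊆)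
open import Data.Integer using (ℤ) renaming (+_ to pos; _-_ to _-ᶻ_; _*_ to _*ᶻ_; _+_ to _+ᶻ_; _<_ to _<ᶻ_; +≤+ to ℤ+≤+; +<+ to ℤ+<+)
import Data.Integer.Properties as ℤ
open import Data.List using (List; []; _∷_; _++_; length; allFin)
open import Data.List.Membership.Propositional using () renaming (_∈_ to _∈ˡ_)
open import Data.List.Membership.Propositional.Properties using (∈-allFin; ∈-++⁺ˡ)
open import Data.List.Properties using (length-++; length-tabulate)
open import Data.List.Relation.Binary.Permutation.Propositional using (_↭_; prep; swap; ↭-refl)
open import Data.List.Relation.Binary.Permutation.Propositional.Properties using (++-comm; shift; ++⁺ʳ; ∈-resp-↭; All-resp-↭)
open import Data.List.Relation.Unary.Any using (here; there)
open import Data.List.Relation.Unary.Unique.Propositional using (Unique)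
open import Data.Nat using (ℕ; zero; suc; _+_; _*_; _∸_; _≤_; _<_; z≤n; s≤s; NonZero; >-nonZero; _≤?_) renaming (_≟_ to _≟ⁿ_)
open import Data.Nat.DivMod using (_%_; m<n*o⇒m/o<n; m≡m%n+[m/n]*n; m%n<n) renaming (_/_ to _div_)
open import Data.Nat.Properties hiding (_≟_; _≤?_)
open import Data.Nat.Tactic.RingSolver using (solve; solve-∀)
open import Data.Product using (_×_; _,_; proj₁; proj₂; ∃-syntax; Σ)
open import Data.Rational using (ℚ; _/_; toℚᵘ) renaming (_<_ to _<ℚ_; _*_ to _*ℚ_)
open import Data.Rational.Properties using (toℚᵘ-mono-<; toℚᵘ-cancel-<; toℚᵘ-homo-*; toℚᵘ-fromℚᵘ) renaming (_<?_ to _<ℚ?_)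
open import Data.Rational.Unnormalised using (mkℚᵘ; *<*) renaming (_<_ to _<ᵘ_; _*_ to _*ᵘ_)
import Data.Rational.Unnormalised.Properties as ℚᵘ
open import Data.Sum using (_⊎_; inj₁; inj₂; [_,_]′)
open import Data.Unit using (tt)
open import Data.Vec.Properties using ([]=⇒lookup; lookup⇒[]=)
open import Function using (_∘_)
open import Relation.Binary.PropositionalEquality using (_≡_; _≢_; refl; sym; trans; cong; cong₂; subst; subst₂; module ≡-Reasoning)
open import Relation.Nullary using (¬_; Dec; yes; no; does; ¬?)
open import Relation.Nullary.Decidable using (dec-true; dec-false; _×-dec_; _⊎-dec_; _→-dec_)
open import Algebra.Properties.CommutativeMonoid.Sum +-0-commutativeMonoid using (sum; ∑-distrib-+; sum-cong-≗)

-- The two complexes compared are complementary: if Y is small, the bound for the link is strong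
-- because it is relative to Y; if Y is close to N, the restriction loses almost no codegree. Both
-- have k - 1 colours, and within one range their inductive bounds share the coefficient of δ, say s
-- δ ≤ b Y for the link and s δ′ ≤ c Y for the restriction. Eliminating Y gives (s + b - c) δ ≤ b N.
-- In one range b = d + 1 and c = d, in the other b = 3 d + 1 and c = 3 d - 2, so raising r by one
-- adds 1 or 3 to the coefficient of δ; this is where the denominators k + 2 and 3 k - 2 come from.
-- The obstacle is that for r from 3 d to 3 d + 2 the restriction lies beyond the meeting point 3 d
-- - 1 of the two ranges for d - 1, so its bound is of the other kind and the coefficients no longer
-- match. At a meeting point both bounds read 4 δ ≤ N, and this common value carries the induction
-- across the gap.

⟦_⟧ : Bool → ℕ
⟦ b ⟧ = if b then 1 else 0

-- Counting with Boolean predicates.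

# : ∀ {n} → (Fin n → Bool) → ℕ
# {zero}  p = 0
# {suc n} p = ⟦ p zero ⟧ + # (p ∘ suc)

#-sum : ∀ {n} (p : Fin n → Bool) → # p ≡ sum (λ i → ⟦ p i ⟧)
#-sum {zero}  p = refl
#-sum {suc n} p = cong (⟦ p zero ⟧ +_) (#-sum (p ∘ suc))

sum-mono : ∀ {n} {f g : Fin n → ℕ} → (∀ i → f i ≤ g i) → sum f ≤ sum g
sum-mono {zero}  f≤g = z≤n
sum-mono {suc n} f≤g = +-mono-≤ (f≤g zero) (sum-mono (f≤g ∘ suc))

∧-intro : ∀ {a b} → a ≡ true → b ≡ true → a ∧ b ≡ true
∧-intro refl refl = refl

∧-elimˡ : ∀ {a b} → a ∧ b ≡ true → a ≡ true
∧-elimˡ {true} _ = refl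

∧-elimʳ : ∀ {a b} → a ∧ b ≡ true → b ≡ true
∧-elimʳ {true} p = p

not-false : ∀ {a} → not a ≡ true → a ≢ true
not-false {true} ()
not-false {false} _ ()

not-intro : ∀ {a} → a ≢ true → not a ≡ true
not-intro {true}  h = ⊥-elim (h refl)
not-intro {false} h = refl

⟦⟧-mono : ∀ {a b} → (a ≡ true → b ≡ true) → ⟦ a ⟧ ≤ ⟦ b ⟧
⟦⟧-mono {false} h = z≤n
⟦⟧-mono {true}  h rewrite h refl = ≤-refl

module _ {n : ℕ} where

  #-mono : {p q : Fin n → Bool} → (∀ i → p i ≡ true → q i ≡ true) → # p ≤ # q
  #-mono {p} {q} h = subst₂ _≤_ (sym (#-sum p)) (sym (#-sum q)) (sum-mono (λ i → ⟦⟧-mono (h i)))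

  #-split : (p q : Fin n → Bool) → # p ≡ # (λ i → p i ∧ q i) + # (λ i → p i ∧ not (q i))
  #-split p q = begin
    # p                                                            ≡⟨ #-sum p ⟩
    sum (λ i → ⟦ p i ⟧)                                            ≡⟨ sum-cong-≗ (λ i → split (p i) (q i)) ⟩
    sum (λ i → ⟦ p i ∧ q i ⟧ + ⟦ p i ∧ not (q i) ⟧)                ≡⟨ ∑-distrib-+ (λ i → ⟦ p i ∧ q i ⟧) (λ i → ⟦ p i ∧ not (q i) ⟧) ⟩
    sum (λ i → ⟦ p i ∧ q i ⟧) + sum (λ i → ⟦ p i ∧ not (q i) ⟧)    ≡⟨ cong₂ _+_ (#-sum (λ i → p i ∧ q i)) (#-sum (λ i → p i ∧ not (q i))) ⟨
    # (λ i → p i ∧ q i) + # (λ i → p i ∧ not (q i))                ∎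
    where
    open ≡-Reasoning
    split : ∀ a b → ⟦ a ⟧ ≡ ⟦ a ∧ b ⟧ + ⟦ a ∧ not b ⟧
    split true  true  = refl
    split true  false = refl
    split false b     = refl

  #-disjoint : {p q s : Fin n → Bool} →
    (∀ i → p i ≡ true → s i ≡ true) → (∀ i → q i ≡ true → s i ≡ true) →
    (∀ i → p i ≡ true → q i ≡ true → ⊥) → # p + # q ≤ # s
  #-disjoint {p} {q} {s} p⊆s q⊆s disj = subst (# p + # q ≤_) (sym (#-split s p))
    (+-mono-≤ (#-mono λ i pi → ∧-intro (p⊆s i pi) pi)
              (#-mono λ i qi → ∧-intro (q⊆s i qi) (not-intro λ pi → disj i pi qi)))

  #-cover : {p q s : Fin n → Bool} →
    (∀ i → s i ≡ true → q i ≢ true → p i ≡ true) → # s ≤ # p + # q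
  #-cover {p} {q} {s} h = ≤-trans (≤-reflexive (trans (#-split s q) (+-comm (# (λ i → s i ∧ q i)) _)))
    (+-mono-≤ (#-mono λ i e → h i (∧-elimˡ e) (not-false (∧-elimʳ {s i} e))) (#-mono λ i e → ∧-elimʳ {s i} e))

#-inhabited : ∀ {n} (p : Fin n → Bool) → 0 < # p → ∃[ i ] p i ≡ true
#-inhabited {suc n} p h with p zero in eq
... | true  = zero , eq
... | false with i , e ← #-inhabited (p ∘ suc) h = suc i , e

#-≤ : ∀ {n} (p : Fin n → Bool) → # p ≤ n
#-≤ {zero}  p = z≤n
#-≤ {suc n} p with p zero
... | true  = s≤s (#-≤ (p ∘ suc))
... | false = m≤n⇒m≤1+n (#-≤ (p ∘ suc))

#-all : ∀ {n} → # {n} (λ _ → true) ≡ n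
#-all {zero}  = refl
#-all {suc n} = cong suc #-all

does-true : ∀ {A : Set} (a? : Dec A) → does a? ≡ true → A
does-true (yes a) _ = a

-- Colour lists and colour classes.

Coloured : ∀ {n k} → (Fin n → Fin k) → (Fin n → Bool) → ℕ → Set
Coloured {k = k} f p m = ∃[ L ] (length {A = Fin k} L ≡ m × (∀ x → p x ≡ true → f x ∈ˡ L))

∈-remove : ∀ {A : Set} (L : List A) {a} → a ∈ˡ L →
  ∃[ L′ ] (suc (length L′) ≡ length L × (∀ {b} → b ∈ˡ L → a ≢ b → b ∈ˡ L′))
∈-remove (a ∷ L) (here refl) = L , refl , λ { (here refl) a≢a → ⊥-elim (a≢a refl) ; (there b∈L) _ → b∈L }
∈-remove (x ∷ L) (there a∈L) with L′ , len , keep ← ∈-remove L a∈L =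
  x ∷ L′ , cong suc len , λ { (here refl) _ → here refl ; (there b∈L) a≢b → there (keep b∈L a≢b) }

Coloured-remove : ∀ {n k m} {f : Fin n → Fin k} {p q : Fin n → Bool} {w} →
  Coloured f p (suc m) → p w ≡ true →
  (∀ x → q x ≡ true → p x ≡ true) → (∀ x → q x ≡ true → f w ≢ f x) → Coloured f q m
Coloured-remove (L , len , cov) pw q⊆p avoid with L′ , len′ , keep ← ∈-remove L (cov _ pw) =
  L′ , suc-injective (trans len′ len) , λ x qx → keep (cov x (q⊆p x qx)) (avoid x qx)

Coloured-zero : ∀ {n k} {f : Fin n → Fin k} {p : Fin n → Bool} → Coloured f p 0 → # p ≡ 0
Coloured-zero {p = p} ([] , refl , cov) with # p in eq
... | zero  = refl
... | suc _ with x , px ← #-inhabited p (subst (0 <_) (sym eq) (s≤s z≤n)) with () ← cov x px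

class : ∀ {n k} → (Fin n → Fin k) → (Fin n → Bool) → Fin k → Fin n → Bool
class f p i x = p x ∧ does (f x ≟ᶠ i)

others : ∀ {n k} → (Fin n → Fin k) → (Fin n → Bool) → Fin k → Fin n → Bool
others f p i x = p x ∧ not (does (f x ≟ᶠ i))

#-class : ∀ {n k} (f : Fin n → Fin k) p i → # p ≡ # (class f p i) + # (others f p i)
#-class f p i = #-split p (λ x → does (f x ≟ᶠ i))

largest-class : ∀ {n k} (f : Fin n → Fin k) (L : List (Fin k)) (p : Fin n → Bool) →
  (∀ x → p x ≡ true → f x ∈ˡ L) → 0 < # p → ∃[ i ] # p ≤ length L * # (class f p i)
largest-class f [] p cov 0<#p with x , px ← #-inhabited p 0<#p with () ← cov x px
largest-class f (i ∷ L) p cov 0<#p = decide (# (others f p i)) refl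
  where
  open ≤-Reasoning
  cov′ : ∀ x → others f p i x ≡ true → f x ∈ˡ L
  cov′ x e with cov x (∧-elimˡ e)
  ... | here fx≡i  = ⊥-elim (not-false (∧-elimʳ {p x} e) (dec-true (f x ≟ᶠ i) fx≡i))
  ... | there fx∈L = fx∈L
  compare : ∃[ j ] # (others f p i) ≤ length L * # (class f (others f p i) j) →
    ∃[ l ] # p ≤ suc (length L) * # (class f p l)
  compare (j , le) = bigger (≤-total (# (class f p i)) (# (class f p j)))
    where
    bound : # p ≤ # (class f p i) + length L * # (class f p j)
    bound = begin
      # p                                             ≡⟨ #-class f p i ⟩
      # (class f p i) + # (others f p i)              ≤⟨ +-monoʳ-≤ (# (class f p i)) le ⟩
      # (class f p i) + length L * # (class f (others f p i) j)
        ≤⟨ +-monoʳ-≤ (# (class f p i)) (*-monoʳ-≤ (length L)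
             (#-mono λ x e → ∧-intro (∧-elimˡ (∧-elimˡ e)) (∧-elimʳ {others f p i x} e))) ⟩
      # (class f p i) + length L * # (class f p j)    ∎
    bigger : # (class f p i) ≤ # (class f p j) ⊎ # (class f p j) ≤ # (class f p i) →
      ∃[ l ] # p ≤ suc (length L) * # (class f p l)
    bigger (inj₁ i≤j) = j , ≤-trans bound (+-monoˡ-≤ _ i≤j)
    bigger (inj₂ j≤i) = i , ≤-trans bound (+-monoʳ-≤ (# (class f p i)) (*-monoʳ-≤ (length L) j≤i))
  decide : ∀ s → # (others f p i) ≡ s → ∃[ l ] # p ≤ suc (length L) * # (class f p l)
  decide zero eq = i , (begin
    # p                                 ≡⟨ #-class f p i ⟩
    # (class f p i) + # (others f p i)  ≡⟨ cong (# (class f p i) +_) eq ⟩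
    # (class f p i) + 0                 ≤⟨ +-monoʳ-≤ (# (class f p i)) z≤n ⟩
    suc (length L) * # (class f p i)    ∎)
  decide (suc s) eq = compare (largest-class f L (others f p i) cov′ (subst (0 <_) (sym eq) (s≤s z≤n)))

-- Complexes of faces: links, restrictions and degree bounds.

module Complexes {n k : ℕ} (φ ϑ : Fin n → Fin k) where

  Faces : Set
  Faces = List (Fin n) → Bool

  vertex : Faces → Fin n → Bool
  vertex F x = F (x ∷ [])

  ∣V_∣ : Faces → ℕ
  ∣V F ∣ = # (vertex F)

  -- The subsets of edges of an r-graph, as lists without repetition: only faces with at most r vertices matter.  This
  -- class, unlike that of r-graphs without isolated vertices, is closed under both links and restrictions.
  record Complex (δ r m : ℕ) (F : Faces) : Set where
    field
      empty  : F [] ≡ true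
      perm   : ∀ {xs ys} → xs ↭ ys → F xs ≡ true → F ys ≡ true
      down   : ∀ {x xs} → F (x ∷ xs) ≡ true → F xs ≡ true
      extend : ∀ xs → F xs ≡ true → length xs < r → δ ≤ # (λ x → F (x ∷ xs))
      φ-edge : ∀ {x y} → F (x ∷ y ∷ []) ≡ true → φ x ≢ φ y
      ϑ-edge : ∀ {x y} → F (x ∷ y ∷ []) ≡ true → ϑ x ≢ ϑ y
      rows   : Coloured φ (vertex F) m
      cols   : Coloured ϑ (vertex F) m

  open Complex

  module _ {δ r m F} (K : Complex δ r m F) where

    drop-++ : ∀ xs {ys} → F (xs ++ ys) ≡ true → F ys ≡ true
    drop-++ []       e = e
    drop-++ (x ∷ xs) e = drop-++ xs (down K e)

    take-++ : ∀ xs {ys} → F (xs ++ ys) ≡ true → F xs ≡ true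
    take-++ xs {ys} e = drop-++ ys (perm K (++-comm xs ys) e)

    head-vertex : ∀ {x xs} → F (x ∷ xs) ≡ true → vertex F x ≡ true
    head-vertex {x} = take-++ (x ∷ [])

    flip-edge : ∀ {x y} → F (x ∷ y ∷ []) ≡ true → F (y ∷ x ∷ []) ≡ true
    flip-edge = perm K (swap _ _ ↭-refl)

    δ≤∣V∣ : 0 < r → δ ≤ ∣V F ∣
    δ≤∣V∣ = extend K [] (empty K)

  link : List (Fin n) → Faces → Faces
  link ws F xs = F (ws ++ xs)

  link₁ : ∀ {δ r m F w} → Complex δ (suc r) (suc m) F → vertex F w ≡ true → Complex δ r m (link (w ∷ []) F)
  link₁ {F = F} {w} K Fw = record
    { empty  = Fw
    ; perm   = λ p → perm K (prep w p)
    ; down   = λ e → down K (perm K (swap _ _ ↭-refl) e)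
    ; extend = λ xs e len → ≤-trans (extend K (w ∷ xs) e (s≤s len)) (#-mono {n} λ x → perm K (swap _ _ ↭-refl))
    ; φ-edge = φ-edge K ∘ down K
    ; ϑ-edge = ϑ-edge K ∘ down K
    ; rows   = Coloured-remove (rows K) Fw (λ _ → down K) (λ _ → φ-edge K)
    ; cols   = Coloured-remove (cols K) Fw (λ _ → down K) (λ _ → ϑ-edge K)
    }

  link-complex : ∀ {δ r m F} ws → Complex δ (length ws + r) (length ws + m) F → F ws ≡ true →
    Complex δ r m (link ws F)
  link-complex []       K e = K
  link-complex (w ∷ ws) K e = link-complex ws (link₁ K (head-vertex K e)) e

  all : (Fin n → Bool) → List (Fin n) → Bool
  all X []       = true
  all X (x ∷ xs) = X x ∧ all X xs

  all-resp-↭ : ∀ X {xs ys} → xs ↭ ys → all X xs ≡ true → all X ys ≡ true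
  all-resp-↭ X _↭_.refl         e = e
  all-resp-↭ X (prep x p)   e = ∧-intro (∧-elimˡ e) (all-resp-↭ X p (∧-elimʳ {X x} e))
  all-resp-↭ X (swap x y p) e = ∧-intro (∧-elimˡ {X y} (∧-elimʳ {X x} e))
    (∧-intro (∧-elimˡ {X x} e) (all-resp-↭ X p (∧-elimʳ {X y} (∧-elimʳ {X x} e))))
  all-resp-↭ X (_↭_.trans p q)  e = all-resp-↭ X q (all-resp-↭ X p e)

  restrict : (Fin n → Bool) → Faces → Faces
  restrict X F xs = F xs ∧ all X xs

  -- A face loses only the extensions outside `X`. In each colouring the colour of `w` does not
  -- occur on `X`, so a colour is saved while the uniformity stays `r`.
  restrict-complex : ∀ {δ r m F w} (X : Fin n → Bool) → Complex δ r (suc m) F → vertex F w ≡ true →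
    (∀ x → X x ≡ true → φ w ≢ φ x × ϑ w ≢ ϑ x) →
    Complex (δ ∸ # (λ x → vertex F x ∧ not (X x))) r m (restrict X F)
  restrict-complex {δ} {r} {m} {F} {w} X K Fw avoid = record
    { empty  = ∧-intro (empty K) refl
    ; perm   = λ p e → ∧-intro (perm K p (∧-elimˡ e)) (all-resp-↭ X p (∧-elimʳ {F _} e))
    ; down   = λ {x} e → ∧-intro (down K (∧-elimˡ e)) (∧-elimʳ {X x} (∧-elimʳ {F _} e))
    ; extend = λ xs e len → m≤n+o⇒m∸n≤o δ _ (≤-trans (extend K xs (∧-elimˡ e) len) (ext xs e))
    ; φ-edge = φ-edge K ∘ ∧-elimˡ
    ; ϑ-edge = ϑ-edge K ∘ ∧-elimˡ
    ; rows   = Coloured-remove (rows K) Fw (λ _ → ∧-elimˡ) (λ x e → proj₁ (avoid x (in-X x e)))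
    ; cols   = Coloured-remove (cols K) Fw (λ _ → ∧-elimˡ) (λ x e → proj₂ (avoid x (in-X x e)))
    }
    where
    in-X : ∀ x → vertex (restrict X F) x ≡ true → X x ≡ true
    in-X x e = ∧-elimˡ (∧-elimʳ {vertex F x} e)
    ext : ∀ xs → restrict X F xs ≡ true →
      # (λ x → F (x ∷ xs)) ≤ # (λ x → vertex F x ∧ not (X x)) + # (λ x → restrict X F (x ∷ xs))
    ext xs e = #-cover {n} λ x Fx no → ∧-intro (head-vertex K Fx)
      (not-intro λ Xx → no (∧-intro Fx (∧-intro Xx (∧-elimʳ {F xs} e))))

  partite-bound-arith : ∀ {e N R Y δ} m → .{{NonZero m}} → m * δ ≤ e * Y → Y + R ≤ N → N ≤ suc m * R →
    suc m * δ ≤ e * N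
  partite-bound-arith {e} {N} {R} {Y} {δ} m mδ Y+R N≤ = *-cancelˡ-≤ m (begin
    m * (suc m * δ)   ≡⟨ solve (m ∷ δ ∷ []) ⟩
    suc m * (m * δ)   ≤⟨ *-monoʳ-≤ (suc m) mδ ⟩
    suc m * (e * Y)   ≡⟨ solve (m ∷ e ∷ Y ∷ []) ⟩
    e * (suc m * Y)   ≤⟨ *-monoʳ-≤ e mY ⟩
    e * (m * N)       ≡⟨ solve (m ∷ e ∷ N ∷ []) ⟩
    m * (e * N)       ∎)
    where
    open ≤-Reasoning
    mY : suc m * Y ≤ m * N
    mY = +-cancelˡ-≤ N _ _ (begin
      N + suc m * Y          ≤⟨ +-monoˡ-≤ _ N≤ ⟩
      suc m * R + suc m * Y  ≡⟨ solve (m ∷ R ∷ Y ∷ []) ⟩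
      suc m * (Y + R)        ≤⟨ *-monoʳ-≤ (suc m) Y+R ⟩
      N + m * N              ∎)

  -- Induction through the link of a vertex in a largest colour class. The link avoids that class,
  -- hence has at most the fraction (m - 1) / m of the vertices, m being the number of colours; `e`
  -- is kept, since uniformity and colours drop together.
  partite-bound : ∀ r e {δ F} → Complex δ (suc r) (r + e) F → (r + e) * δ ≤ e * ∣V F ∣
  partite-bound zero    e K = *-monoʳ-≤ e (δ≤∣V∣ K (s≤s z≤n))
  partite-bound (suc r) e {δ} {F} K = by-size ∣V F ∣ refl
    where
    open ≤-Reasoning
    from-vertex : ∀ i → ∣V F ∣ ≤ suc (r + e) * # (class φ (vertex F) i) →
      ∃[ x ] class φ (vertex F) i x ≡ true → suc (r + e) * δ ≤ e * ∣V F ∣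
    from-vertex i big (x , ex) = by-rows (r + e) refl
      where
      L  = link₁ K (∧-elimˡ {vertex F x} ex)
      smaller : # (λ y → F (x ∷ y ∷ [])) + # (class φ (vertex F) i) ≤ ∣V F ∣
      smaller = #-disjoint {n} (λ y → down K) (λ y → ∧-elimˡ {vertex F y})
        (λ y xy ey → φ-edge K xy (trans (does-true (φ x ≟ᶠ i) (∧-elimʳ {vertex F x} ex)) (sym (does-true (φ y ≟ᶠ i) (∧-elimʳ {vertex F y} ey)))))
      by-rows : ∀ m → r + e ≡ m → suc (r + e) * δ ≤ e * ∣V F ∣
      -- No colour is left for the link, so it has no vertices and δ = 0. `partite-bound-arith`
      -- divides by the number of colours of the link and cannot be used here.
      by-rows zero eq = begin
        suc (r + e) * δ  ≤⟨ *-monoʳ-≤ (suc (r + e)) (δ≤∣V∣ L (s≤s z≤n)) ⟩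
        suc (r + e) * # (λ y → F (x ∷ y ∷ []))
          ≡⟨ cong (suc (r + e) *_) (Coloured-zero (subst (Coloured φ _) eq (rows L))) ⟩
        suc (r + e) * 0  ≡⟨ *-zeroʳ (suc (r + e)) ⟩
        0                ≤⟨ z≤n ⟩
        e * ∣V F ∣       ∎
      by-rows (suc m) eq = subst (λ l → suc l * δ ≤ e * ∣V F ∣) (sym eq)
        (partite-bound-arith {e} {R = # (class φ (vertex F) i)} {Y = ∣V link (x ∷ []) F ∣} (suc m) (subst (λ l → l * δ ≤ e * ∣V link (x ∷ []) F ∣) eq (partite-bound r e L)) smaller
          (subst (λ l → ∣V F ∣ ≤ suc l * # (class φ (vertex F) i)) eq big))
    by-size : ∀ s → ∣V F ∣ ≡ s → suc (r + e) * δ ≤ e * ∣V F ∣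
    by-size zero eq = begin
      suc (r + e) * δ  ≤⟨ *-monoʳ-≤ (suc (r + e)) (≤-trans (δ≤∣V∣ K (s≤s z≤n)) (≤-reflexive eq)) ⟩
      suc (r + e) * 0  ≡⟨ *-zeroʳ (suc (r + e)) ⟩
      0                ≤⟨ z≤n ⟩
      e * ∣V F ∣       ∎
    by-size (suc s) eq = from-class (subst (λ l → ∃[ i ] ∣V F ∣ ≤ l * # (class φ (vertex F) i)) (proj₁ (proj₂ (rows K)))
        (largest-class φ (proj₁ (rows K)) (vertex F) (proj₂ (proj₂ (rows K))) (subst (0 <_) (sym eq) (s≤s z≤n))))
      where
      from-class : ∃[ i ] ∣V F ∣ ≤ suc (r + e) * # (class φ (vertex F) i) → suc (r + e) * δ ≤ e * ∣V F ∣
      from-class (i , big) = from-vertex i big (#-inhabited _ (n≢0⇒n>0 λ none →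
        1+n≢0 (trans (sym eq) (n≤0⇒n≡0 (≤-trans big (≤-reflexive (trans (cong (suc (r + e) *_) none) (*-zeroʳ (suc (r + e)))))))))) 

  same-colour : ∀ {f : Fin n → Fin k} {p x y} → Coloured f p 1 → p x ≡ true → p y ≡ true → f x ≡ f y
  same-colour (c ∷ [] , refl , cov) px py with here eq ← cov _ px | here eq′ ← cov _ py = trans eq (sym eq′)

  -- Passing to links of neighbours of `x` uses up uniformity and colours together. At uniformity
  -- one only the colour of `x` remains, and all of the δ vertices there carry it.
  row-bound : ∀ r {δ F x} → Complex δ (suc r) (suc r) F → vertex F x ≡ true → δ ≤ # (class φ (vertex F) (φ x))
  row-bound zero {F = F} {x} K Fx = ≤-trans (δ≤∣V∣ K (s≤s z≤n))
    (#-mono {n} λ y Fy → ∧-intro Fy (dec-true (φ y ≟ᶠ φ x) (same-colour (rows K) Fy Fx)))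
  row-bound (suc r) {zero}      K Fx = z≤n
  row-bound (suc r) {suc δ} {F} {x} K Fx
    with y , yx ← #-inhabited (λ y → F (y ∷ x ∷ [])) (≤-trans (s≤s z≤n) (extend K (x ∷ []) Fx (s≤s (s≤s z≤n)))) =
    ≤-trans (row-bound r (link₁ K (head-vertex K yx)) yx)
      (#-mono {n} λ z e → ∧-intro (down K (∧-elimˡ e)) (∧-elimʳ {F (y ∷ z ∷ [])} e))

  -- A conflicting pair: common neighbours and the omission of vertices.

  module Conflict (u v : Fin n) (φu≡φv : φ u ≡ φ v) (ϑu≢ϑv : ϑ u ≢ ϑ v) where

    NoCommonNeighbour : Faces → Set
    NoCommonNeighbour F = ∀ w → F (w ∷ u ∷ []) ≡ true → F (w ∷ v ∷ []) ≡ true → ⊥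

    -- The neighbourhoods of `u` and `v` are disjoint and, as `φ u ≡ φ v`, both miss the row of `u`;
    -- each is large by `partite-bound` in the link. The superset `P` serves for complexes that are
    -- links themselves: the row can then be counted in the larger set `common F ws`.
    no-common-bound : ∀ r d {δ F} (P : Fin n → Bool) → Complex δ (2 + r) (2 + r + d) F →
      vertex F u ≡ true → vertex F v ≡ true → NoCommonNeighbour F →
      (∀ x → vertex F x ≡ true → P x ≡ true) →
      2 * ((r + suc d) * δ) + suc d * # (class φ P (φ u)) ≤ suc d * # P
    no-common-bound r d {δ} {F} P K Fu Fv none V⊆P = begin
      2 * ((r + suc d) * δ) + suc d * R                         ≡⟨ cong (_+ suc d * R) (cong ((r + suc d) * δ +_) (+-identityʳ _)) ⟩
      (r + suc d) * δ + (r + suc d) * δ + suc d * R             ≤⟨ +-monoˡ-≤ (suc d * R) (+-mono-≤ (degree Fu) (degree Fv)) ⟩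
      suc d * # (N u) + suc d * # (N v) + suc d * R             ≡⟨ collect d (# (N u)) (# (N v)) R ⟩
      suc d * (R + (# (N u) + # (N v)))                         ≤⟨ *-monoʳ-≤ (suc d) (+-monoʳ-≤ R disjoint) ⟩
      suc d * (R + # (others φ P (φ u)))                        ≡⟨ cong (suc d *_) (#-class φ P (φ u)) ⟨
      suc d * # P                                               ∎
      where
      open ≤-Reasoning
      R = # (class φ P (φ u))
      collect : ∀ d a b c → suc d * a + suc d * b + suc d * c ≡ suc d * (c + (a + b))
      collect = solve-∀
      N : Fin n → Fin n → Bool
      N x y = F (x ∷ y ∷ [])
      degree : ∀ {x} → vertex F x ≡ true → (r + suc d) * δ ≤ suc d * # (N x)
      degree {x} Fx = partite-bound r (suc d) (subst (λ m → Complex δ (suc r) m (link (x ∷ []) F)) (sym (+-suc r d)) (link₁ K Fx))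
      off-row : ∀ {x} → φ x ≡ φ u → ∀ y → N x y ≡ true → others φ P (φ u) y ≡ true
      off-row φx y xy = ∧-intro (V⊆P y (down K xy))
        (not-intro λ e → φ-edge K xy (trans φx (sym (does-true (φ y ≟ᶠ φ u) e))))
      disjoint : # (N u) + # (N v) ≤ # (others φ P (φ u))
      disjoint = #-disjoint {n} (off-row refl) (off-row (sym φu≡φv))
        (λ y uy vy → none y (flip-edge K uy) (flip-edge K vy))

    -- Common neighbours are chosen greedily. If the choice stops before `j` vertices,
    -- `no-common-bound` applies to the link reached.
    chain : ∀ j F → vertex F u ≡ true → vertex F v ≡ true →
      (∃[ ws ] (length ws ≡ j × F (ws ++ u ∷ []) ≡ true × F (ws ++ v ∷ []) ≡ true)) ⊎
      (∃[ ws ] (length ws < j × F (ws ++ u ∷ []) ≡ true × F (ws ++ v ∷ []) ≡ true × NoCommonNeighbour (link ws F)))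
    chain zero    F Fu Fv = inj₁ ([] , refl , Fu , Fv)
    chain (suc j) F Fu Fv with any? (λ w → (F (w ∷ u ∷ []) ≟ᵇ true) ×-dec (F (w ∷ v ∷ []) ≟ᵇ true))
    ... | no none = inj₂ ([] , s≤s z≤n , Fu , Fv , λ w wu wv → none (w , wu , wv))
    ... | yes (w , wu , wv) with chain j (link (w ∷ []) F) wu wv
    ...   | inj₁ (ws , len , e)  = inj₁ (w ∷ ws , cong suc len , e)
    ...   | inj₂ (ws , len , e)  = inj₂ (w ∷ ws , s≤s len , e)

    narrow : Faces → (Fin n → Bool) → List (Fin n) → Fin n → Bool
    narrow F p []       = p
    narrow F p (w ∷ ws) = narrow F (λ x → p x ∧ F (w ∷ x ∷ [])) ws

    narrow-intro : ∀ F p ws {x} → p x ≡ true → (∀ {w} → w ∈ˡ ws → F (w ∷ x ∷ []) ≡ true) → narrow F p ws x ≡ true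
    narrow-intro F p []       px adj = px
    narrow-intro F p (w ∷ ws) px adj = narrow-intro F _ ws (∧-intro px (adj (here refl))) (adj ∘ there)

    common : Faces → List (Fin n) → Fin n → Bool
    common F = narrow F (vertex F)

    -- Telescoping: `p` is the disjoint union of `narrow F p ws` and, for each `w` in `ws`, the
    -- vertices first lost at `w`.
    omit-sum : ∀ F X A Z ws p →
      (∀ pre w post → ws ≡ pre ++ w ∷ post → X ≤ A * # (λ x → narrow F p pre x ∧ not (F (w ∷ x ∷ []))) + Z) →
      length ws * X + A * # (narrow F p ws) ≤ A * # p + length ws * Z
    omit-sum F X A Z []       p bound = m≤m+n (A * # p) 0
    omit-sum F X A Z (w ∷ ws) p bound = begin
      suc l * X + A * Y                 ≡⟨ +-assoc X (l * X) (A * Y) ⟩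
      X + (l * X + A * Y)               ≤⟨ +-mono-≤ (bound [] w ws refl)
                                            (omit-sum F X A Z ws _ (λ pre w′ post eq → bound (w ∷ pre) w′ post (cong (w ∷_) eq))) ⟩
      A * q + Z + (A * p′ + l * Z)      ≡⟨ collect l Z A q p′ ⟩
      A * (p′ + q) + suc l * Z          ≡⟨ cong (λ s → A * s + suc l * Z) (#-split p (λ x → F (w ∷ x ∷ []))) ⟨
      A * # p + suc l * Z               ∎
      where
      open ≤-Reasoning
      collect : ∀ l Z A q p → A * q + Z + (A * p + l * Z) ≡ A * (p + q) + suc l * Z
      collect = solve-∀
      l = length ws
      Y = # (narrow F p (w ∷ ws))
      p′ = # (λ x → p x ∧ F (w ∷ x ∷ []))
      q = # (λ x → p x ∧ not (F (w ∷ x ∷ [])))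

    link-adjacent : ∀ {δ r m F w x} (K : Complex δ r m F) ws → F (ws ++ x ∷ []) ≡ true → w ∈ˡ ws → F (w ∷ x ∷ []) ≡ true
    link-adjacent {x = x} K (w ∷ ws) e (here refl) = take-++ K (w ∷ x ∷ []) (perm K (prep w (++-comm ws (x ∷ []))) e)
    link-adjacent K (w ∷ ws) e (there w∈ws) = link-adjacent K ws (down K e) w∈ws

    link⊆common : ∀ {δ r m F} (K : Complex δ r m F) ws x → vertex (link ws F) x ≡ true → common F ws x ≡ true
    link⊆common {F = F} K ws x e = narrow-intro F (vertex F) ws (drop-++ K ws e) (link-adjacent K ws e)

    -- Faces containing all of ws except w, inside the neighbourhood of w: one colour is lost but no vertex is spent, at the
    -- price of the extensions that are not adjacent to w.  These losses are disjoint for different w, whence omit-sum.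
    omitted : ∀ {δ r m F} pre w post → let ws = pre ++ w ∷ post in
      Complex δ (length (pre ++ post) + r) (length (pre ++ post) + suc m) F →
      F (ws ++ u ∷ []) ≡ true → F (ws ++ v ∷ []) ≡ true →
      ∃[ δ′ ] ∃[ G ] (Complex δ′ r m G × vertex G u ≡ true × vertex G v ≡ true
        × δ ≤ # (λ x → common F pre x ∧ not (F (w ∷ x ∷ []))) + δ′
        × (∀ x → vertex G x ≡ true → common F ws x ≡ true))
    omitted {δ} {r} {m} {F} pre w post K Fu Fv =
      δ ∸ C , restrict X L
      , restrict-complex X LK Lw (λ x wx → φ-edge K wx , ϑ-edge K wx)
      , still u Fu , still v Fv
      , ≤-trans (m≤n+m∸n δ C) (+-monoˡ-≤ (δ ∸ C) (#-mono {n} λ x e → ∧-intro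
          (narrow-intro F (vertex F) pre (drop-++ K (pre ++ post) (∧-elimˡ e))
            (link-adjacent K (pre ++ post) (∧-elimˡ e) ∘ ∈-++⁺ˡ))
          (∧-elimʳ {vertex L x} e)))
      , λ x e → narrow-intro F (vertex F) ws (drop-++ K (pre ++ post) (∧-elimˡ e)) (adjacent x e)
      where
      ws = pre ++ w ∷ post
      X : Fin n → Bool
      X x = F (w ∷ x ∷ [])
      L = link (pre ++ post) F
      C = # (λ x → vertex L x ∧ not (X x))
      front : ∀ x → F (ws ++ x ∷ []) ≡ true → F (w ∷ (pre ++ post) ++ x ∷ []) ≡ true
      front x = perm K (++⁺ʳ (x ∷ []) (shift w pre post))
      LK : Complex δ r (suc m) L
      LK = link-complex (pre ++ post) K (take-++ K (pre ++ post) (down K (front u Fu)))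
      Lw : vertex L w ≡ true
      Lw = perm K (++-comm (w ∷ []) (pre ++ post)) (take-++ K (w ∷ pre ++ post) (front u Fu))
      still : ∀ x → F (ws ++ x ∷ []) ≡ true → vertex (restrict X L) x ≡ true
      still x e = ∧-intro (down K (front x e)) (∧-intro (link-adjacent K (w ∷ pre ++ post) (front x e) (here refl)) refl)
      adjacent : ∀ x → vertex (restrict X L) x ≡ true → ∀ {y} → y ∈ˡ ws → F (y ∷ x ∷ []) ≡ true
      adjacent x e y∈ws with ∈-resp-↭ (shift w pre post) y∈ws
      ... | here refl = ∧-elimˡ (∧-elimʳ {vertex L x} e)
      ... | there y∈  = link-adjacent K (pre ++ post) (∧-elimˡ e) y∈

    record Bound (A B r m : ℕ) : Set where
      field at : ∀ {δ F} → Complex δ r m F → vertex F u ≡ true → vertex F v ≡ true → A * δ ≤ B * ∣V F ∣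

    open Bound public

    length-omit : ∀ {i} (pre : List (Fin n)) {w post ws} → length ws ≡ suc i → ws ≡ pre ++ w ∷ post → i ≡ length (pre ++ post)
    length-omit pre {w} {post} len refl = suc-injective (trans (sym len) (trans (length-++ pre)
      (trans (+-suc (length pre) (length post)) (cong suc (sym (length-++ pre))))))

    -- The inductive bound is applied once for each omitted vertex. Each of the complexes lives
    -- inside `common F ws`, and their losses add up to the vertices outside it.
    omit-bound : ∀ {A B i r m δ F} ws → Bound A B r m → length ws ≡ suc i → Complex δ (i + r) (i + suc m) F →
      F (ws ++ u ∷ []) ≡ true → F (ws ++ v ∷ []) ≡ true →
      suc i * (A * δ) + A * # (common F ws) ≤ A * ∣V F ∣ + suc i * (B * # (common F ws))
    omit-bound {A} {B} {i} {r} {m} {δ} {F} ws bound len K Fu Fv =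
      subst (λ l → l * (A * δ) + A * Y ≤ A * ∣V F ∣ + l * (B * Y)) len
        (omit-sum F (A * δ) A (B * Y) ws (vertex F) each)
      where
      open ≤-Reasoning
      Y = # (common F ws)
      each : ∀ pre w post → ws ≡ pre ++ w ∷ post → A * δ ≤ A * # (λ x → common F pre x ∧ not (F (w ∷ x ∷ []))) + B * Y
      each pre w post refl
        with δ′ , G , GK , Gu , Gv , δ≤ , G⊆ ← omitted {δ} {r} {m} pre w post
               (subst (λ l → Complex δ (l + r) (l + suc m) F) (length-omit pre len refl) K) Fu Fv = begin
        A * δ              ≤⟨ *-monoʳ-≤ A δ≤ ⟩
        A * (D + δ′)       ≡⟨ *-distribˡ-+ A D δ′ ⟩
        A * D + A * δ′     ≤⟨ +-monoʳ-≤ (A * D) (at bound GK Gu Gv) ⟩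
        A * D + B * ∣V G ∣ ≤⟨ +-monoʳ-≤ (A * D) (*-monoʳ-≤ B (#-mono {n} G⊆)) ⟩
        A * D + B * Y      ∎
        where D = # (λ x → common F pre x ∧ not (F (w ∷ x ∷ [])))

    -- The hypothesis reserves t δ vertices of `common F ws` outside the row of `u`. The omitted
    -- complexes have as many colours as their uniformity, so `row-bound` finds a further δ, less
    -- the loss, inside that row.
    omit-row-bound : ∀ {i r t δ F} ws → length ws ≡ suc i → Complex δ (i + suc r) (i + suc (suc r)) F →
      F (ws ++ u ∷ []) ≡ true → F (ws ++ v ∷ []) ≡ true →
      t * δ + # (class φ (common F ws) (φ u)) ≤ # (common F ws) →
      suc i * (suc t * δ) ≤ ∣V F ∣ + i * # (common F ws)
    omit-row-bound {i} {r} {t} {δ} {F} ws len K Fu Fv tδ = +-cancelʳ-≤ Y _ _ (begin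
      suc i * (suc t * δ) + Y        ≡⟨ cong₂ _+_ (cong (_* (suc t * δ)) (sym len)) (sym (*-identityˡ Y)) ⟩
      length ws * (suc t * δ) + 1 * Y ≤⟨ omit-sum F (suc t * δ) 1 Y ws (vertex F) each ⟩
      1 * ∣V F ∣ + length ws * Y     ≡⟨ cong₂ _+_ (*-identityˡ ∣V F ∣) (cong (_* Y) len) ⟩
      ∣V F ∣ + (Y + i * Y)           ≡⟨ cong (∣V F ∣ +_) (+-comm Y (i * Y)) ⟩
      ∣V F ∣ + (i * Y + Y)           ≡⟨ +-assoc ∣V F ∣ (i * Y) Y ⟨
      ∣V F ∣ + i * Y + Y             ∎)
      where
      open ≤-Reasoning
      Y = # (common F ws)
      R = # (class φ (common F ws) (φ u))
      each : ∀ pre w post → ws ≡ pre ++ w ∷ post → suc t * δ ≤ 1 * # (λ x → common F pre x ∧ not (F (w ∷ x ∷ []))) + Y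
      each pre w post refl
        with δ′ , G , GK , Gu , Gv , δ≤ , G⊆ ← omitted {δ} {suc r} {suc r} pre w post
               (subst (λ l → Complex δ (l + suc r) (l + suc (suc r)) F) (length-omit pre len refl) K) Fu Fv = begin
        δ + t * δ         ≤⟨ +-monoˡ-≤ (t * δ) δ≤ ⟩
        D + δ′ + t * δ    ≤⟨ +-monoˡ-≤ (t * δ) (+-monoʳ-≤ D (≤-trans (row-bound r GK Gu)
                               (#-mono {n} λ x e → ∧-intro (G⊆ x (∧-elimˡ e)) (∧-elimʳ {vertex G x} e)))) ⟩
        D + R + t * δ     ≡⟨ trans (+-assoc D R (t * δ)) (cong (D +_) (+-comm R (t * δ))) ⟩
        D + (t * δ + R)   ≤⟨ +-monoʳ-≤ D tδ ⟩
        D + Y             ≡⟨ cong (_+ Y) (*-identityˡ D) ⟨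
        1 * D + Y         ∎
        where D = # (λ x → common F pre x ∧ not (F (w ∷ x ∷ [])))

-- Linear arithmetic: elimination of Y.

ratio : ∀ {a c f δ N} b → .{{NonZero b}} → c * b ≤ f * a → a * δ ≤ b * N → c * δ ≤ f * N
ratio {a} {c} {f} {δ} {N} b cb≤fa aδ≤bN = *-cancelˡ-≤ b (begin
  b * (c * δ)  ≡⟨ solve (b ∷ c ∷ δ ∷ []) ⟩
  c * b * δ    ≤⟨ *-monoˡ-≤ δ cb≤fa ⟩
  f * a * δ    ≡⟨ *-assoc f a δ ⟩
  f * (a * δ)  ≤⟨ *-monoʳ-≤ f aδ≤bN ⟩
  f * (b * N)  ≡⟨ solve (b ∷ f ∷ N ∷ []) ⟩
  b * (f * N)  ∎)
  where open ≤-Reasoning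

≤-combine : ∀ x y {a b c d} → a ≤ b → c ≤ d → x * a + y * c ≤ x * b + y * d
≤-combine x y a≤b c≤d = +-mono-≤ (*-monoʳ-≤ x a≤b) (*-monoʳ-≤ y c≤d)

≤-by : ∀ {a b} c → a + c ≡ b → a ≤ b
≤-by {a} c eq = ≤-trans (m≤m+n a c) (≤-reflexive eq)

-- Y is the number of neighbours of w; it is eliminated between the bounds for the link of w and for the restriction to it.
one-step-arith : ∀ {δ N Y} s a b c → .{{NonZero s}} → a + c ≡ s →
  s * δ ≤ b * Y → 1 * (s * δ) + s * Y ≤ s * N + 1 * (c * Y) → (a + b) * δ ≤ b * N
one-step-arith {δ} {N} {Y} s a b c refl inLink omit =
  *-cancelˡ-≤ (a + c) (+-cancelʳ-≤ (b * (a + c) * Y) _ _ (begin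
    (a + c) * ((a + b) * δ) + b * (a + c) * Y           ≡⟨ solve (a ∷ b ∷ c ∷ δ ∷ Y ∷ []) ⟩
    a * ((a + c) * δ) + b * (1 * ((a + c) * δ) + (a + c) * Y)  ≤⟨ ≤-combine a b inLink omit ⟩
    a * (b * Y) + b * ((a + c) * N + 1 * (c * Y))       ≡⟨ solve (a ∷ b ∷ c ∷ N ∷ Y ∷ []) ⟩
    (a + c) * (b * N) + b * (a + c) * Y                 ∎))
  where open ≤-Reasoning

-- With weights `j′` and 3 e + 4 the right side collects (j + j′) (3 e + 4) Y, which cancels against
-- the left because j + j′ = 4. At j = 4 the link bound has weight 0, so four vertices are the most
-- that can be used.
boundary-arith : ∀ {δ N Y} e j j′ → j + j′ ≡ 4 →
  4 * (3 * e + 1) * δ ≤ (3 * e + 4) * Y → j * (4 * δ) + 4 * Y ≤ 4 * N + j * (1 * Y) →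
  (12 * e + 4 + 3 * j) * δ ≤ (3 * e + 4) * N
boundary-arith {δ} {N} {Y} e j j′ sum≡4 inLink omit = *-cancelˡ-≤ 4 (+-cancelʳ-≤ ((3 * e + 4) * (4 * Y)) _ _ (begin
  4 * ((12 * e + 4 + 3 * j) * δ) + (3 * e + 4) * (4 * Y)
    ≡⟨ solve (e ∷ j ∷ δ ∷ Y ∷ []) ⟩
  4 * ((3 * e * 4 + 4 + 3 * j) * δ) + (3 * e + 4) * (4 * Y)
    ≡⟨ cong (λ s → 4 * ((3 * e * s + s + 3 * j) * δ) + (3 * e + 4) * (4 * Y)) sum≡4 ⟨
  4 * ((3 * e * (j + j′) + (j + j′) + 3 * j) * δ) + (3 * e + 4) * (4 * Y)
    ≡⟨ solve (e ∷ j ∷ j′ ∷ δ ∷ Y ∷ []) ⟩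
  j′ * (4 * (3 * e + 1) * δ) + (3 * e + 4) * (j * (4 * δ) + 4 * Y)
    ≤⟨ ≤-combine j′ (3 * e + 4) inLink omit ⟩
  j′ * ((3 * e + 4) * Y) + (3 * e + 4) * (4 * N + j * (1 * Y))
    ≡⟨ solve (e ∷ j ∷ j′ ∷ N ∷ Y ∷ []) ⟩
  4 * ((3 * e + 4) * N) + (3 * e + 4) * ((j + j′) * Y)
    ≡⟨ cong (λ s → 4 * ((3 * e + 4) * N) + (3 * e + 4) * (s * Y)) sum≡4 ⟩
  4 * ((3 * e + 4) * N) + (3 * e + 4) * (4 * Y) ∎))
  where open ≤-Reasoning

-- The weights are `i` and `g`. The terms in Y agree because suc (g + i) = l + 5.
stuck-arith : ∀ {δ N Y} i l g → g + i ≡ l + 4 →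
  suc i * ((l + 5) * δ) + (l + 5) * Y ≤ (l + 5) * N + suc i * (1 * Y) → suc i * (suc (l + 2) * δ) ≤ N + i * Y →
  (suc i * (i * (l + 5) + g * (l + 3))) * δ ≤ (i * (l + 5) + g) * N
stuck-arith {δ} {N} {Y} i l g g+i omit omitRow = +-cancelʳ-≤ (i * ((l + 5) * Y)) _ _ (begin
  (suc i * (i * (l + 5) + g * (l + 3))) * δ + i * ((l + 5) * Y)
    ≡⟨ solve (i ∷ l ∷ g ∷ δ ∷ Y ∷ []) ⟩
  i * (suc i * ((l + 5) * δ) + (l + 5) * Y) + g * (suc i * (suc (l + 2) * δ))
    ≤⟨ ≤-combine i g omit omitRow ⟩
  i * ((l + 5) * N + suc i * (1 * Y)) + g * (N + i * Y)
    ≡⟨ solve (i ∷ l ∷ g ∷ N ∷ Y ∷ []) ⟩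
  (i * (l + 5) + g) * N + i * (suc (g + i) * Y)
    ≡⟨ cong (λ s → (i * (l + 5) + g) * N + i * (s * Y)) (trans (cong suc g+i) (sym (+-suc l 4))) ⟩
  (i * (l + 5) + g) * N + i * ((l + 5) * Y) ∎)
  where open ≤-Reasoning

-- Six pairs satisfy i + l ≤ 2. Only i = 2, l = 0, a chain stuck after three of four vertices, is
-- tight: 48 / 12 = 16 / 4.
small-cases : ∀ i l {δ N} → suc (suc i + l) ≤ 4 →
  suc i * (i * (l + 5) + (l + 4 ∸ i) * (l + 3)) * δ ≤ (i * (l + 5) + (l + 4 ∸ i)) * N →
  (4 + 3 * suc (suc i + l)) * δ ≤ 4 * N
small-cases 0 0 {δ} {N} _ = ratio {12} {10} {4} {δ} {N} 4  (≤ᵇ⇒≤ _ _ tt)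
small-cases 0 1 {δ} {N} _ = ratio {20} {13} {4} {δ} {N} 5  (≤ᵇ⇒≤ _ _ tt)
small-cases 0 2 {δ} {N} _ = ratio {30} {16} {4} {δ} {N} 6  (≤ᵇ⇒≤ _ _ tt)
small-cases 1 0 {δ} {N} _ = ratio {28} {13} {4} {δ} {N} 8  (≤ᵇ⇒≤ _ _ tt)
small-cases 1 1 {δ} {N} _ = ratio {44} {16} {4} {δ} {N} 10 (≤ᵇ⇒≤ _ _ tt)
small-cases 2 0 {δ} {N} _ = ratio {48} {16} {4} {δ} {N} 12 (≤ᵇ⇒≤ _ _ tt)
small-cases 0 (suc (suc (suc l))) (s≤s (s≤s (s≤s (s≤s ()))))
small-cases 1 (suc (suc l)) (s≤s (s≤s (s≤s (s≤s ()))))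
small-cases 2 (suc l) (s≤s (s≤s (s≤s (s≤s ()))))
small-cases (suc (suc (suc i))) l (s≤s (s≤s (s≤s (s≤s ()))))

-- The bounds for both ranges, by induction on d.

module Bounds {n k : ℕ} (φ ϑ : Fin n → Fin k) (u v : Fin n) (φu≡φv : φ u ≡ φ v) (ϑu≢ϑv : ϑ u ≢ ϑ v) where

  open Complexes φ ϑ
  open Complex
  open Conflict u v φu≡φv ϑu≢ϑv

  two-colours : ∀ {f : Fin n → Fin k} {p : Fin n → Bool} {a b x} → Coloured f p 2 →
    p a ≡ true → p b ≡ true → p x ≡ true → f a ≢ f b → f a ≢ f x → f x ≡ f b
  two-colours {f} {p} {a} C pa pb px a≢b a≢x =
    same-colour (Coloured-remove {p = p} {q = others f p (f a)} C pa (λ y → ∧-elimˡ)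
        (λ y e eq → not-false (∧-elimʳ {p y} e) (dec-true (f y ≟ᶠ f a) (sym eq))))
      (avoids px a≢x) (avoids pb a≢b)
    where
    avoids : ∀ {y} → p y ≡ true → f a ≢ f y → others f p (f a) y ≡ true
    avoids {y} py a≢y = ∧-intro py (not-intro λ e → a≢y (sym (does-true (f y ≟ᶠ f a) e)))

  -- A neighbour of `u` and a neighbour of `v` complete the two vertices to all four pairs of
  -- colours. Adjacent vertices differ in both colours, so the four neighbourhoods lie in four
  -- different pairs and are disjoint.
  bipartite-bound : Bound 4 1 2 2
  at bipartite-bound {zero}      K Fu Fv = z≤n
  at bipartite-bound {suc δ} {F} K Fu Fv =
    from-neighbours (#-inhabited (N u) (≤-trans (s≤s z≤n) (degree Fu))) (#-inhabited (N v) (≤-trans (s≤s z≤n) (degree Fv)))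
    where
    open ≤-Reasoning
    N : Fin n → Fin n → Bool
    N x y = F (x ∷ y ∷ [])
    degree : ∀ {x} → vertex F x ≡ true → suc δ ≤ # (N x)
    degree Fx = ≤-trans (extend K _ Fx (s≤s (s≤s z≤n))) (#-mono {n} λ y → flip-edge K)
    from-neighbours : ∃[ x ] N u x ≡ true → ∃[ y ] N v y ≡ true → 4 * suc δ ≤ 1 * ∣V F ∣
    from-neighbours (x , ux) (y , vy) = begin
      4 * suc δ                                  ≡⟨ solve (δ ∷ []) ⟩
      (suc δ + suc δ) + (suc δ + suc δ)          ≤⟨ +-mono-≤ (+-mono-≤ (degree Fx) (degree Fy)) (+-mono-≤ (degree Fu) (degree Fv)) ⟩
      (# (N x) + # (N y)) + (# (N u) + # (N v))  ≤⟨ +-mono-≤ in-total off-total ⟩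
      # (class φ (vertex F) (φ u)) + # (others φ (vertex F) (φ u)) ≡⟨ #-class φ (vertex F) (φ u) ⟨
      ∣V F ∣                                     ≡⟨ *-identityˡ ∣V F ∣ ⟨
      1 * ∣V F ∣                                 ∎
      where
      Fx = down K ux
      Fy = down K vy
      φu≢φy : φ u ≢ φ y
      φu≢φy eq = φ-edge K vy (trans (sym φu≡φv) eq)
      φy≡φx : φ y ≡ φ x
      φy≡φx = two-colours (rows K) Fu Fx Fy (φ-edge K ux) φu≢φy
      ϑx≡ϑv : ϑ x ≡ ϑ v
      ϑx≡ϑv = two-colours (cols K) Fu Fv Fx ϑu≢ϑv (ϑ-edge K ux)
      ϑy≡ϑu : ϑ y ≡ ϑ u
      ϑy≡ϑu = two-colours (cols K) Fv Fu Fy (λ eq → ϑu≢ϑv (sym eq)) (ϑ-edge K vy)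
      not-both : ∀ {a b} → ϑ a ≡ ϑ u → ϑ b ≡ ϑ v → ∀ z → N a z ≡ true → N b z ≡ true → ⊥
      not-both a≡u b≡v z az bz = ϑ-edge K bz (trans b≡v (sym
        (two-colours (cols K) Fu Fv (down K bz) ϑu≢ϑv (λ u≡z → ϑ-edge K az (trans a≡u u≡z)))))
      in-row : ∀ {a} → φ a ≡ φ x → ∀ z → N a z ≡ true → class φ (vertex F) (φ u) z ≡ true
      in-row a≡x z az = ∧-intro (down K az) (dec-true (φ z ≟ᶠ φ u)
        (two-colours (rows K) Fx Fu (down K az) (λ eq → φ-edge K ux (sym eq)) (λ x≡z → φ-edge K az (trans a≡x x≡z))))
      off-row : ∀ {a} → φ a ≡ φ u → ∀ z → N a z ≡ true → others φ (vertex F) (φ u) z ≡ true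
      off-row a≡u z az = ∧-intro (down K az)
        (not-intro λ e → φ-edge K az (trans a≡u (sym (does-true (φ z ≟ᶠ φ u) e))))
      in-total : # (N x) + # (N y) ≤ # (class φ (vertex F) (φ u))
      in-total = #-disjoint {n} (in-row refl) (in-row φy≡φx) (λ z xz yz → not-both ϑy≡ϑu ϑx≡ϑv z yz xz)
      off-total : # (N u) + # (N v) ≤ # (others φ (vertex F) (φ u))
      off-total = #-disjoint {n} (off-row refl) (off-row (sym φu≡φv)) (not-both refl refl)

  Bound-cong : ∀ {A A′ B B′ r r′ m m′} → Bound A B r m → A ≡ A′ → B ≡ B′ → r ≡ r′ → m ≡ m′ → Bound A′ B′ r′ m′
  Bound-cong b refl refl refl refl = b

  in-link : ∀ {A B l r m δ F} ws → Bound A B r m → length ws ≡ l → Complex δ (l + r) (l + m) F →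
    F (ws ++ u ∷ []) ≡ true → F (ws ++ v ∷ []) ≡ true → A * δ ≤ B * # (common F ws)
  in-link {B = B} ws bound refl K Fu Fv = ≤-trans (at bound (link-complex ws K (take-++ K ws Fu)) Fu Fv)
    (*-monoʳ-≤ B (#-mono {n} (link⊆common K ws)))

  -- The common coefficient `s` is split as a + c only to express A = s + b - c without subtraction.
  one-step : ∀ r d s a b c {A B} → .{{NonZero s}} → a + c ≡ s → a + b ≡ A → b ≡ B →
    Bound s b r (r + d) → Bound s c (suc r) (r + d) →
    (∀ {δ F} → Complex δ (suc r) (suc r + d) F → vertex F u ≡ true → vertex F v ≡ true → NoCommonNeighbour F →
      A * δ ≤ B * ∣V F ∣) →
    Bound A B (suc r) (suc r + d)
  one-step r d s a b c a+c refl refl linkBound omitBound stuck .at {δ} {F} K Fu Fv with chain 1 F Fu Fv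
  ... | inj₂ ([] , _ , _ , _ , none) = stuck K Fu Fv none
  ... | inj₂ (_ ∷ _ , s≤s () , _)
  ... | inj₁ (ws@(_ ∷ []) , refl , wu , wv) = one-step-arith s a b c a+c (in-link ws linkBound refl K wu wv)
          (omit-bound {i = 0} {r = suc r} {m = r + d} ws omitBound refl K wu wv)

  -- Degrees alone suffice for positive `d`. For d = 0 and r = 0 they give 4 δ where 5 δ is wanted,
  -- and `row-bound` supplies the missing δ.
  high-stuck : ∀ r d {δ F} → Complex δ (3 + r) (3 + r + d) F → vertex F u ≡ true → vertex F v ≡ true →
    NoCommonNeighbour F → (3 + r + d + 2) * δ ≤ suc d * ∣V F ∣
  high-stuck r zero {δ} {F} K Fu Fv none = begin
    (3 + r + 0 + 2) * δ                ≤⟨ ≤-by (r * δ) (solve (r ∷ δ ∷ [])) ⟩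
    2 * ((suc r + 1) * δ) + 1 * δ      ≤⟨ +-monoʳ-≤ (2 * ((suc r + 1) * δ)) (*-monoʳ-≤ 1
      (row-bound (2 + r) (subst (λ m → Complex δ (3 + r) m F) (+-identityʳ (3 + r)) K) Fu)) ⟩
    2 * ((suc r + 1) * δ) + 1 * # (class φ (vertex F) (φ u))
                                       ≤⟨ no-common-bound (suc r) 0 (vertex F) K Fu Fv none (λ _ e → e) ⟩
    1 * ∣V F ∣                         ∎
    where open ≤-Reasoning
  high-stuck r (suc d) {δ} {F} K Fu Fv none = begin
    (3 + r + suc d + 2) * δ            ≤⟨ ≤-by ((r + d) * δ) (solve (r ∷ d ∷ δ ∷ [])) ⟩
    2 * ((suc r + suc (suc d)) * δ)    ≤⟨ m≤m+n _ _ ⟩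
    2 * ((suc r + suc (suc d)) * δ) + suc (suc d) * # (class φ (vertex F) (φ u))
                                       ≤⟨ no-common-bound (suc r) (suc d) (vertex F) K Fu Fv none (λ _ e → e) ⟩
    suc (suc d) * ∣V F ∣               ∎
    where open ≤-Reasoning

  low-stuck : ∀ r e {δ F} → Complex δ (2 + r) (2 + r + suc e) F → vertex F u ≡ true → vertex F v ≡ true →
    NoCommonNeighbour F → (3 * suc r + 3 * suc e + 1) * δ ≤ (3 * suc e + 1) * ∣V F ∣
  low-stuck r e {δ} {F} K Fu Fv none = ratio {2 * (r + suc (suc e))} {3 * suc r + 3 * suc e + 1} {3 * suc e + 1} (2 + e)
    (≤-by (r * (3 * e + 2) + 3 * e * e + 7 * e + 2) (solve (r ∷ e ∷ [])))
    (begin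
      2 * (r + suc (suc e)) * δ      ≡⟨ *-assoc 2 (r + suc (suc e)) δ ⟩
      2 * ((r + suc (suc e)) * δ)    ≤⟨ m≤m+n _ _ ⟩
      2 * ((r + suc (suc e)) * δ) + suc (suc e) * # (class φ (vertex F) (φ u))
                                     ≤⟨ no-common-bound r (suc e) (vertex F) K Fu Fv none (λ _ e → e) ⟩
      (2 + e) * ∣V F ∣               ∎)
    where open ≤-Reasoning

  -- `Low` is indexed by one less than the uniformity, so 3 k - 2 appears as 3 r + 3 d + 1. Both
  -- ranges include the uniformity 3 d + 2, where both ratios equal 4; `Mid` is this common bound in
  -- lowest terms.
  Low Mid High : ℕ → Set
  Low  d = ∀ r → suc r ≤ 3 * d + 2 → Bound (3 * r + 3 * d + 1) (3 * d + 1) (suc r) (suc r + d)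
  Mid  d = Bound 4 1 (3 * d + 2) (3 * d + 2 + d)
  High d = ∀ r → 3 * d + 2 ≤ r → Bound (r + d + 2) (suc d) r (r + d)

  -- For e = 0 the plain degree bound is too weak, and the colour class of u has to be counted as well (omit-row-bound).
  boundary-stuck : ∀ e i l {δ F} ws → length ws ≡ i → suc (i + l) ≤ 4 → High 0 →
    let j = suc (i + l) in
    Complex δ (j + (3 * e + 1)) (j + (3 * e + 1) + suc e) F →
    F (ws ++ u ∷ []) ≡ true → F (ws ++ v ∷ []) ≡ true → NoCommonNeighbour (link ws F) →
    (12 * e + 4 + 3 * j) * δ ≤ (3 * e + 4) * ∣V F ∣
  boundary-stuck e i l {δ} {F} ws len j≤4 high₀ K Fu Fv none = by-cases e i refl refl
    where
    open ≤-Reasoning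
    j = suc (i + l)
    reindex : ∀ i l e → suc (i + l) + (3 * e + 1) ≡ i + (2 + (l + 3 * e))
    reindex = solve-∀
    reindex′ : ∀ i l e → suc (i + l) + (3 * e + 1) + suc e ≡ i + (2 + (l + 3 * e) + suc e)
    reindex′ = solve-∀
    L : Complex δ (2 + (l + 3 * e)) (2 + (l + 3 * e) + suc e) (link ws F)
    L = link-complex ws (subst₂ (λ r m → Complex δ r m F)
      (trans (reindex i l e) (cong (_+ _) (sym len))) (trans (reindex′ i l e) (cong (_+ _) (sym len))) K) (take-++ K ws Fu)
    stuck : ∀ P → (∀ x → vertex (link ws F) x ≡ true → P x ≡ true) →
      2 * ((l + 3 * e + (2 + e)) * δ) + (2 + e) * # (class φ P (φ u)) ≤ (2 + e) * # P
    stuck P = no-common-bound (l + 3 * e) (suc e) P L Fu Fv none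
    by-cases : ∀ e′ i′ → e ≡ e′ → i ≡ i′ → (12 * e + 4 + 3 * j) * δ ≤ (3 * e + 4) * ∣V F ∣
    -- As `j` ≤ 4, the bound 4 δ ≤ N is enough, and for positive `e` the degrees give it.
    by-cases (suc f) _ refl _ = ratio {4} {12 * e + 4 + 3 * j} {3 * e + 4} {δ} {∣V F ∣} 1
      (begin
        (12 * e + 4 + 3 * j) * 1  ≡⟨ *-identityʳ _ ⟩
        12 * e + 4 + 3 * j        ≤⟨ +-monoʳ-≤ (12 * e + 4) (*-monoʳ-≤ 3 j≤4) ⟩
        12 * e + 4 + 3 * 4        ≡⟨ solve (f ∷ []) ⟩
        (3 * e + 4) * 4           ∎)
      (ratio {2 * (l + 3 * e + (2 + e))} {4} {1} {δ} {∣V F ∣} (2 + e) (≤-by (2 * l + 4 * f) (solve (l ∷ f ∷ []))) (begin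
        2 * (l + 3 * e + (2 + e)) * δ    ≡⟨ *-assoc 2 (l + 3 * e + (2 + e)) δ ⟩
        2 * ((l + 3 * e + (2 + e)) * δ)  ≤⟨ m≤m+n _ _ ⟩
        2 * ((l + 3 * e + (2 + e)) * δ) + (2 + e) * # (class φ (vertex F) (φ u))
                                         ≤⟨ stuck (vertex F) (λ x → drop-++ K ws) ⟩
        (2 + e) * ∣V F ∣                 ∎))
    by-cases zero zero refl refl = ratio {2 * (l + 2)} {4 + 3 * suc l} {4} {δ} {∣V F ∣} 2 (≤-by (2 * l + 2) (solve (l ∷ [])))
      (begin
        2 * (l + 2) * δ          ≡⟨ solve (l ∷ δ ∷ []) ⟩
        2 * ((l + 0 + 2) * δ)    ≤⟨ m≤m+n _ _ ⟩
        2 * ((l + 0 + 2) * δ) + 2 * # (class φ (vertex F) (φ u)) ≤⟨ stuck (vertex F) (λ x → drop-++ K ws) ⟩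
        2 * ∣V F ∣               ∎)
    -- Omitting a vertex leaves uniformity and number of colours both equal to l + 3, so `High 0`
    -- and `row-bound` are both available.
    by-cases zero (suc i) refl refl =
      small-cases i l j≤4 (stuck-arith {δ} {∣V F ∣} {Y} i l g (m∸n+n≡m i≤l+4) omit omitRow)
      where
      g = l + 4 ∸ i
      i≤l+4 : i ≤ l + 4
      i≤l+4 = ≤-trans (≤-trans (m≤n+m i 2) (≤-trans (m≤m+n (2 + i) l) j≤4)) (m≤n+m 4 l)
      Y = # (common F ws)
      narrow-row : (l + 2) * δ + # (class φ (common F ws) (φ u)) ≤ Y
      narrow-row = *-cancelˡ-≤ 2 (begin
        2 * ((l + 2) * δ + # (class φ (common F ws) (φ u)))          ≡⟨ collect l δ (# (class φ (common F ws) (φ u))) ⟩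
        2 * ((l + 0 + 2) * δ) + 2 * # (class φ (common F ws) (φ u))  ≤⟨ stuck (common F ws) (link⊆common K ws) ⟩
        2 * Y                                                        ∎)
        where
        collect : ∀ l δ R → 2 * ((l + 2) * δ + R) ≡ 2 * ((l + 0 + 2) * δ) + 2 * R
        collect = solve-∀
      shape : ∀ i l → suc (suc i + l) + 1 ≡ i + (l + 3)
      shape = solve-∀
      shape′ : ∀ i l → suc (suc i + l) + 1 + 1 ≡ i + suc (l + 3 + 0)
      shape′ = solve-∀
      omit : suc i * ((l + 5) * δ) + (l + 5) * Y ≤ (l + 5) * ∣V F ∣ + suc i * (1 * Y)
      omit = omit-bound {i = i} {r = l + 3} {m = l + 3 + 0} ws
        (Bound-cong (high₀ (l + 3) (≤-by (suc l) (coefficient′ l))) (coefficient l) refl refl refl) len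
        (subst₂ (λ r m → Complex δ r m F) (shape i l) (shape′ i l) K) Fu Fv
        where
        coefficient : ∀ l → l + 3 + 0 + 2 ≡ l + 5
        coefficient = solve-∀
        coefficient′ : ∀ l → 2 + suc l ≡ l + 3
        coefficient′ = solve-∀
      omitRow : suc i * (suc (l + 2) * δ) ≤ ∣V F ∣ + i * Y
      omitRow = omit-row-bound {i} {l + 2} {l + 2} ws len
        (subst₂ (λ r m → Complex δ r m F) (shape″ i l) (shape‴ i l) K) Fu Fv narrow-row
        where
        shape″ : ∀ i l → suc (suc i + l) + 1 ≡ i + suc (l + 2)
        shape″ = solve-∀
        shape‴ : ∀ i l → suc (suc i + l) + 1 + 1 ≡ i + suc (suc (l + 2))
        shape‴ = solve-∀

  -- r = suc j + (3 * e + 1) lies in the low range for d = suc e, but omitting a single vertex leads to the high range for e,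
  -- where the bound is too weak; omitting one of suc j vertices in turn leads to the common end 3 * e + 2 of both ranges.
  boundary : ∀ e j j′ → suc j + j′ ≡ 4 → High 0 → Mid e →
    Bound (4 * (3 * e + 1)) (3 * e + 4) (3 * e + 1) (3 * e + 1 + suc e) →
    Bound (12 * e + 4 + 3 * suc j) (3 * e + 4) (suc j + (3 * e + 1)) (suc j + (3 * e + 1) + suc e)
  boundary e j j′ sum≡4 high₀ mid low .at {δ} {F} K Fu Fv with chain (suc j) F Fu Fv
  ... | inj₁ (ws , len , wu , wv) = boundary-arith {δ} {∣V F ∣} {# (common F ws)} e (suc j) j′ sum≡4
      (in-link ws low len (subst (λ m → Complex δ (suc j + (3 * e + 1)) m F) (+-assoc (suc j) (3 * e + 1) (suc e)) K) wu wv)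
      (omit-bound ws mid len (subst₂ (λ r m → Complex δ r m F) (shape j e) (shape′ j e) K) wu wv)
    where
    shape : ∀ j e → suc j + (3 * e + 1) ≡ j + (3 * e + 2)
    shape = solve-∀
    shape′ : ∀ j e → suc j + (3 * e + 1) + suc e ≡ j + suc (3 * e + 2 + e)
    shape′ = solve-∀
  ... | inj₂ (ws , s≤s i≤j , wu , wv , none) =
      subst (λ j → (12 * e + 4 + 3 * suc j) * δ ≤ (3 * e + 4) * ∣V F ∣) i+l≡j
        (boundary-stuck e (length ws) (j ∸ length ws) ws refl j≤4 high₀
          (subst (λ j → Complex δ (suc j + (3 * e + 1)) (suc j + (3 * e + 1) + suc e) F) (sym i+l≡j) K) wu wv none)
    where
    i+l≡j : length ws + (j ∸ length ws) ≡ j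
    i+l≡j = m+[n∸m]≡n i≤j
    j≤4 : suc (length ws + (j ∸ length ws)) ≤ 4
    j≤4 = subst (λ j → suc j ≤ 4) (sym i+l≡j) (≤-by j′ sum≡4)

  Low-zero : Low 0
  Low-zero zero          _ .at K Fu Fv = *-monoʳ-≤ 1 (δ≤∣V∣ K (s≤s z≤n))
  Low-zero (suc zero)    _ = bipartite-bound
  Low-zero (suc (suc r)) (s≤s (s≤s ()))

  high-step : ∀ r d → Bound (2 + r + d + 2) (suc d) (2 + r) (2 + r + d) → Bound (2 + r + d + 2) d (3 + r) (2 + r + d) →
    Bound (3 + r + d + 2) (suc d) (3 + r) (3 + r + d)
  high-step r d linkBound omitBound = one-step (2 + r) d (2 + r + d + 2) (4 + r) (suc d) d
    (solve (r ∷ d ∷ [])) (solve (r ∷ d ∷ [])) refl linkBound omitBound (high-stuck r d)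

  High-from : ∀ d r₀ → Bound (2 + r₀ + d + 2) (suc d) (2 + r₀) (2 + r₀ + d) →
    (∀ r → r₀ ≤ r → Bound (2 + r + d + 2) d (3 + r) (2 + r + d)) →
    ∀ r → 2 + r₀ ≤ r → Bound (r + d + 2) (suc d) r (r + d)
  High-from d r₀ base omitBound r r₀≤r = subst (λ r → Bound (r + d + 2) (suc d) r (r + d)) (m+[n∸m]≡n r₀≤r) (go (r ∸ (2 + r₀)))
    where
    go : ∀ o → Bound (2 + r₀ + o + d + 2) (suc d) (2 + r₀ + o) (2 + r₀ + o + d)
    go zero    = subst (λ r → Bound (r + d + 2) (suc d) r (r + d)) (sym (+-identityʳ (2 + r₀))) base
    go (suc o) = subst (λ r → Bound (r + d + 2) (suc d) r (r + d)) (sym (+-suc (2 + r₀) o))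
      (high-step (r₀ + o) d (go o) (omitBound (r₀ + o) (m≤m+n r₀ o)))

  High-zero : High 0
  High-zero = High-from 0 0 bipartite-bound too-few-colours
    where
    -- This is the case d = -1 of the induction: with fewer colours than the uniformity,
    -- `partite-bound` at e = 0 forces δ = 0.
    too-few-colours : ∀ r → 0 ≤ r → Bound (2 + r + 0 + 2) 0 (3 + r) (2 + r + 0)
    too-few-colours r _ .at {δ} K Fu Fv = ≤-trans (*-monoʳ-≤ (2 + r + 0 + 2) (m+n≤o⇒m≤o δ (partite-bound (2 + r) 0 K)))
      (≤-reflexive (*-zeroʳ (2 + r + 0 + 2)))

  module Step (e : ℕ) (lowₑ : Low e) (midₑ : Mid e) (highₑ : High e) where

    -- Up to uniformity 3 e + 2 the restriction stays in the low range for `e`, so a single vertex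
    -- suffices.
    Low-small : ∀ r → suc r ≤ 3 * e + 2 → Bound (3 * r + 3 * suc e + 1) (3 * suc e + 1) (suc r) (suc r + suc e)
    Low-small zero    _  .at {δ} {F} K Fu Fv = *-monoʳ-≤ (3 * suc e + 1) (δ≤∣V∣ K (s≤s z≤n))
    Low-small (suc r) r≤ = one-step (suc r) (suc e) (3 * r + 3 * suc e + 1) (3 * suc r) (3 * suc e + 1) (3 * e + 1)
      {{>-nonZero (m≤n+m 1 (3 * r + 3 * suc e))}}
      (solve (r ∷ e ∷ [])) (solve (r ∷ e ∷ [])) refl
      (Low-small r (≤-trans (n≤1+n _) r≤))
      (Bound-cong (lowₑ (suc r) r≤) (solve (r ∷ e ∷ [])) refl refl (solve (r ∷ e ∷ [])))
      (low-stuck r e)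

    boundary′ : ∀ j j′ → suc j + j′ ≡ 4 →
      Bound (12 * e + 4 + 3 * suc j) (3 * e + 4) (suc j + (3 * e + 1)) (suc j + (3 * e + 1) + suc e)
    boundary′ j j′ sum≡4 = boundary e j j′ sum≡4 High-zero midₑ
      (Bound-cong (Low-small (3 * e) (≤-by 1 (solve (e ∷ [])))) (solve (e ∷ [])) (solve (e ∷ [])) (solve (e ∷ [])) (solve (e ∷ [])))

    -- Beyond `Low-small` only the uniformities 3 e + 3, 3 e + 4 and 3 e + 5 remain; `boundary`
    -- reaches them with two, three and four vertices.
    low : Low (suc e)
    low r r≤ with suc r ≤? 3 * e + 2
    ... | yes small = Low-small r small
    ... | no  large = from-j (r ∸ (3 * e + 2)) (m+[n∸m]≡n (≤-pred (≰⇒> large)))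
      where
      at-j : ∀ j j′ → suc j + j′ ≡ 4 → 3 * e + 1 + j ≡ r → Bound (3 * r + 3 * suc e + 1) (3 * suc e + 1) (suc r) (suc r + suc e)
      at-j j j′ sum≡4 refl = Bound-cong (boundary′ j j′ sum≡4) (solve (e ∷ j ∷ [])) (solve (e ∷ [])) (solve (e ∷ j ∷ [])) (solve (e ∷ j ∷ []))
      reindex : ∀ e o → 3 * e + 1 + suc o ≡ 3 * e + 2 + o
      reindex = solve-∀
      too-large : ∀ e o → suc (3 * suc e + 2) + o ≡ suc (3 * e + 2 + suc (suc (suc o)))
      too-large = solve-∀
      from-j : ∀ o → 3 * e + 2 + o ≡ r → Bound (3 * r + 3 * suc e + 1) (3 * suc e + 1) (suc r) (suc r + suc e)
      from-j 0 eq = at-j 1 2 refl (trans (reindex e 0) eq)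
      from-j 1 eq = at-j 2 1 refl (trans (reindex e 1) eq)
      from-j 2 eq = at-j 3 0 refl (trans (reindex e 2) eq)
      from-j (suc (suc (suc o))) refl = ⊥-elim (<⇒≱ (≤-by o (too-large e o)) r≤)

    -- The case of four vertices, where 12 e + 16 = 4 (3 e + 4).
    mid : Mid (suc e)
    mid = Bound-cong quarter refl refl (solve (e ∷ [])) (solve (e ∷ []))
      where
      quarter : Bound 4 1 (4 + (3 * e + 1)) (4 + (3 * e + 1) + suc e)
      quarter .at {δ} {F} K Fu Fv = ratio {12 * e + 16} {4} {1} {δ} {∣V F ∣} (3 * e + 4) {{>-nonZero (≤-trans (s≤s z≤n) (m≤n+m 4 (3 * e)))}}
        (≤-reflexive (solve (e ∷ [])))
        (≤-trans (≤-reflexive (cong (_* δ) (sym (+-assoc (12 * e) 4 12)))) (at (boundary′ 3 0 refl) K Fu Fv))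

    high : High (suc e)
    high r r≥ = High-from (suc e) (3 * suc e) base omitBound r (≤-trans (≤-reflexive (+-comm 2 (3 * suc e))) r≥)
      where
      room : ∀ e → 3 * e + 2 + 4 ≡ 3 + 3 * suc e
      room = solve-∀
      omitBound : ∀ r → 3 * suc e ≤ r → Bound (2 + r + suc e + 2) (suc e) (3 + r) (2 + r + suc e)
      omitBound r r≥ = Bound-cong (highₑ (3 + r) (≤-trans (≤-by 4 (room e)) (+-monoʳ-≤ 3 r≥)))
        (solve (r ∷ e ∷ [])) refl refl (solve (r ∷ e ∷ []))
      mid′ : Bound 4 1 (2 + 3 * suc e) (2 + 3 * suc e + suc e)
      mid′ = Bound-cong mid refl refl (+-comm (3 * suc e) 2) (cong (_+ suc e) (+-comm (3 * suc e) 2))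
      base : Bound (2 + 3 * suc e + suc e + 2) (suc (suc e)) (2 + 3 * suc e) (2 + 3 * suc e + suc e)
      base .at {δ} {F} K Fu Fv = ratio {4} {2 + 3 * suc e + suc e + 2} {suc (suc e)} {δ} {∣V F ∣} 1 (≤-reflexive (solve (e ∷ [])))
        (at mid′ K Fu Fv)

  bounds : ∀ d → Low d × Mid d × High d
  bounds zero    = Low-zero , bipartite-bound , High-zero
  bounds (suc e) with lowₑ , midₑ , highₑ ← bounds e = low , mid , high
    where open Step e lowₑ midₑ highₑ

-- Rational inequalities as inequalities of natural numbers.

fraction-< : ∀ (a b : ℤ) d e → a / suc d <ℚ b / suc e → a *ᶻ pos (suc e) <ᶻ b *ᶻ pos (suc d)
fraction-< a b d e lt = ℚᵘ.drop-*<* {mkℚᵘ a d} {mkℚᵘ b e}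
  (ℚᵘ.<-respˡ-≃ (toℚᵘ-fromℚᵘ (mkℚᵘ a d)) (ℚᵘ.<-respʳ-≃ (toℚᵘ-fromℚᵘ (mkℚᵘ b e)) (toℚᵘ-mono-< lt)))

fraction-<⁻¹ : ∀ (a b : ℤ) d e → a *ᶻ pos (suc e) <ᶻ b *ᶻ pos (suc d) → a / suc d <ℚ b / suc e
fraction-<⁻¹ a b d e lt = toℚᵘ-cancel-<
  (ℚᵘ.<-respˡ-≃ (ℚᵘ.≃-sym (toℚᵘ-fromℚᵘ (mkℚᵘ a d))) (ℚᵘ.<-respʳ-≃ (ℚᵘ.≃-sym (toℚᵘ-fromℚᵘ (mkℚᵘ b e))) (*<* {mkℚᵘ a d} {mkℚᵘ b e} lt)))

scaled-< : ∀ a d n m → (pos a) / suc d *ℚ ℕ→ℚ n <ℚ ℕ→ℚ m → a * n < m * suc d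
scaled-< a d n m lt = ℤ.drop‿+<+ (subst₂ _<ᶻ_ left right (ℚᵘ.drop-*<* {mkℚᵘ (pos a) d *ᵘ mkℚᵘ (pos n) 0} {mkℚᵘ (pos m) 0}
    (ℚᵘ.<-respˡ-≃ (ℚᵘ.≃-trans (toℚᵘ-homo-* ((pos a) / suc d) (ℕ→ℚ n))
        (ℚᵘ.*-cong (toℚᵘ-fromℚᵘ (mkℚᵘ (pos a) d)) (toℚᵘ-fromℚᵘ (mkℚᵘ (pos n) 0))))
      (ℚᵘ.<-respʳ-≃ (toℚᵘ-fromℚᵘ (mkℚᵘ (pos m) 0)) (toℚᵘ-mono-< lt)))))
  where
  left : pos a *ᶻ pos n *ᶻ pos 1 ≡ pos (a * n)
  left = trans (ℤ.*-identityʳ _) (sym (ℤ.pos-* a n))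
  right : pos m *ᶻ pos (suc (0 + d * 1)) ≡ pos (m * suc d)
  right = trans (cong (λ s → pos m *ᶻ pos (suc s)) (*-identityʳ d)) (sym (ℤ.pos-* m (suc d)))

below-fraction : ∀ a d m x → x <ℚ (pos a) / suc d → a ≤ m → x *ℚ ℕ→ℚ (suc d) <ℚ ℕ→ℚ m
below-fraction a d m x lt a≤m = toℚᵘ-cancel-<
  (ℚᵘ.<-respˡ-≃ (ℚᵘ.≃-sym (ℚᵘ.≃-trans (toℚᵘ-homo-* x (ℕ→ℚ (suc d)))
      (ℚᵘ.*-cong (ℚᵘ.≃-refl {toℚᵘ x}) (toℚᵘ-fromℚᵘ (mkℚᵘ (pos (suc d)) 0)))))
    (ℚᵘ.<-respʳ-≃ (ℚᵘ.≃-sym (toℚᵘ-fromℚᵘ (mkℚᵘ (pos m) 0)))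
      (unnormalised (toℚᵘ x) (ℚᵘ.<-respʳ-≃ (toℚᵘ-fromℚᵘ (mkℚᵘ (pos a) d)) (toℚᵘ-mono-< lt)))))
  where
  unnormalised : ∀ y → y <ᵘ mkℚᵘ (pos a) d → y *ᵘ mkℚᵘ (pos (suc d)) 0 <ᵘ mkℚᵘ (pos m) 0
  unnormalised (mkℚᵘ p q) (*<* lt) = *<* (ℤ.<-≤-trans
    (subst (_<ᶻ pos a *ᶻ pos (suc q)) (sym (ℤ.*-identityʳ (p *ᶻ pos (suc d)))) lt)
    (ℤ.≤-trans (ℤ.*-monoʳ-≤-nonNeg (pos (suc q)) (ℤ+≤+ a≤m)) (ℤ.≤-reflexive (cong (λ s → pos m *ᶻ pos (suc s)) (sym (*-identityʳ q))))))

ℤ-∸ : ∀ m n → n ≤ m → pos m -ᶻ pos n ≡ pos (m ∸ n)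
ℤ-∸ m n n≤m = trans (ℤ.m-n≡m⊖n m n) (ℤ.⊖-≥ n≤m)

-- For k = r + d the condition k < (4 r - 2) / 3 says 3 d + 2 < r. Weakening it to 3 d + 2 ≤ r is
-- harmless, as `High` and `Low` both cover the meeting point.
c-range : ∀ r d → 1 ≤ r →
  (3 * d + 2 ≤ r × c (r + d) r ≡ pos (suc d) / suc (suc (r + d))) ⊎
  (r ≤ 3 * d + 2 × c (r + d) r ≡ (pos (3 * d + 1)) / suc (3 * (r + d) ∸ 3))
c-range r d 1≤r = range (ℕ→ℚ (r + d) <ℚ? limit)
  where
  open ≤-Reasoning
  limit = (pos (4 * r) -ᶻ pos 2) / 3
  first = (pos (r + d) -ᶻ pos r +ᶻ pos 1) / suc (suc (r + d))
  second = (pos (3 * (r + d)) -ᶻ pos (3 * r) +ᶻ pos 1) / suc (3 * (r + d) ∸ 3)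
  2≤4r : 2 ≤ 4 * r
  2≤4r = ≤-trans (s≤s (s≤s z≤n)) (*-monoʳ-≤ 4 1≤r)
  limit-numerator : (pos (4 * r) -ᶻ pos 2) *ᶻ pos 1 ≡ pos (4 * r ∸ 2)
  limit-numerator = trans (ℤ.*-identityʳ _) (ℤ-∸ (4 * r) 2 2≤4r)
  below : ℕ→ℚ (r + d) <ℚ limit → (r + d) * 3 < 4 * r ∸ 2
  below lt = ℤ.drop‿+<+ (subst₂ _<ᶻ_ (sym (ℤ.pos-* (r + d) 3)) limit-numerator (fraction-< (pos (r + d)) (pos (4 * r) -ᶻ pos 2) 0 2 lt))
  below⁻¹ : (r + d) * 3 < 4 * r ∸ 2 → ℕ→ℚ (r + d) <ℚ limit
  below⁻¹ lt = fraction-<⁻¹ (pos (r + d)) (pos (4 * r) -ᶻ pos 2) 0 2 (subst₂ _<ᶻ_ (ℤ.pos-* (r + d) 3) (sym limit-numerator) (ℤ+<+ lt))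
  first-numerator : pos (r + d) -ᶻ pos r +ᶻ pos 1 ≡ pos (suc d)
  first-numerator = trans (cong (_+ᶻ pos 1) (trans (ℤ-∸ (r + d) r (m≤m+n r d)) (cong pos (m+n∸m≡n r d)))) (cong pos (+-comm d 1))
  second-numerator : pos (3 * (r + d)) -ᶻ pos (3 * r) +ᶻ pos 1 ≡ pos (3 * d + 1)
  second-numerator = cong (_+ᶻ pos 1) (trans (ℤ-∸ (3 * (r + d)) (3 * r) (*-monoʳ-≤ 3 (m≤m+n r d)))
    (cong pos (trans (cong (_∸ 3 * r) (*-distribˡ-+ 3 r d)) (m+n∸m≡n (3 * r) (3 * d)))))
  range : Dec (ℕ→ℚ (r + d) <ℚ limit) → _
  range (yes lt) = inj₁ (<⇒≤ (+-cancelˡ-< (3 * r) _ _ (begin-strict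
      3 * r + (3 * d + 2)   ≡⟨ solve (r ∷ d ∷ []) ⟩
      (r + d) * 3 + 2       <⟨ +-monoˡ-< 2 (below lt) ⟩
      4 * r ∸ 2 + 2         ≡⟨ m∸n+n≡m 2≤4r ⟩
      4 * r                 ≡⟨ solve (r ∷ []) ⟩
      3 * r + r             ∎)) ,
    trans (cong (λ b → if b then first else second) (dec-true (ℕ→ℚ (r + d) <ℚ? limit) lt))
      (cong (_/ suc (suc (r + d))) first-numerator))
  range (no ¬lt) = inj₂ (+-cancelˡ-≤ (3 * r) _ _ (begin
      3 * r + r                 ≡⟨ solve (r ∷ []) ⟩
      4 * r                     ≡⟨ m∸n+n≡m 2≤4r ⟨
      4 * r ∸ 2 + 2             ≤⟨ +-monoˡ-≤ 2 (≮⇒≥ λ lt → ¬lt (below⁻¹ lt)) ⟩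
      (r + d) * 3 + 2           ≡⟨ solve (r ∷ d ∷ []) ⟩
      3 * r + (3 * d + 2)       ∎) ,
    trans (cong (λ b → if b then first else second) (dec-false (ℕ→ℚ (r + d) <ℚ? limit) ¬lt))
      (cong (_/ suc (3 * (r + d) ∸ 3)) second-numerator))

open import Data.List.Relation.Unary.All using (All; []; _∷_) renaming (all? to allᴸ?)
import Data.List.Relation.Unary.All as All
open import Data.List.Relation.Unary.AllPairs using ([]; _∷_; allPairs?)
open import Data.Vec using ([]; _∷_; tabulate; lookup; here; there)

-- From r-graphs to complexes of faces.

∣tabulate∣ : ∀ {n} (p : Fin n → Bool) → ∣ tabulate p ∣ ≡ # p
∣tabulate∣ {zero}  p = refl
∣tabulate∣ {suc n} p with p zero
... | true  = cong suc (∣tabulate∣ (p ∘ suc))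
... | false = ∣tabulate∣ (p ∘ suc)

∣p∪⁅x⁆∣≤ : ∀ {n} (p : Subset n) x → ∣ p ∪ ⁅ x ⁆ ∣ ≤ suc ∣ p ∣
∣p∪⁅x⁆∣≤ (inside  ∷ p) zero    rewrite ∪-identityʳ p = n≤1+n _
∣p∪⁅x⁆∣≤ (outside ∷ p) zero    rewrite ∪-identityʳ p = ≤-refl
∣p∪⁅x⁆∣≤ (inside  ∷ p) (suc x) = s≤s (∣p∪⁅x⁆∣≤ p x)
∣p∪⁅x⁆∣≤ (outside ∷ p) (suc x) = ∣p∪⁅x⁆∣≤ p x

⊆-∷ : ∀ {n s t} {p q : Subset n} → p ⊆ q → (s ≡ inside → t ≡ inside) → (s ∷ p) ⊆ (t ∷ q)
⊆-∷ p⊆q h here rewrite h refl = here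
⊆-∷ p⊆q h (there x∈p) = there (p⊆q x∈p)

⊆-interpolate : ∀ {n} (p q : Subset n) j → p ⊆ q → ∣ p ∣ ≤ j → j ≤ ∣ q ∣ →
  ∃[ t ] (p ⊆ t × t ⊆ q × ∣ t ∣ ≡ j)
⊆-interpolate [] [] zero _ _ _ = [] , (λ ()) , (λ ()) , refl
⊆-interpolate (inside ∷ p) (outside ∷ q) j p⊆q _ _ with () ← p⊆q here
⊆-interpolate (inside ∷ p) (inside ∷ q) (suc j) p⊆q (s≤s lo) (s≤s hi)
  with t , p⊆t , t⊆q , eq ← ⊆-interpolate p q j (drop-∷-⊆ p⊆q) lo hi =
  inside ∷ t , ⊆-∷ p⊆t (λ e → e) , ⊆-∷ t⊆q (λ e → e) , cong suc eq
⊆-interpolate (outside ∷ p) (outside ∷ q) j p⊆q lo hi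
  with t , p⊆t , t⊆q , eq ← ⊆-interpolate p q j (drop-∷-⊆ p⊆q) lo hi =
  outside ∷ t , ⊆-∷ p⊆t (λ e → e) , ⊆-∷ t⊆q (λ e → e) , eq
⊆-interpolate (outside ∷ p) (inside ∷ q) j p⊆q lo hi with j ≤? ∣ q ∣
... | yes j≤ with t , p⊆t , t⊆q , eq ← ⊆-interpolate p q j (drop-∷-⊆ p⊆q) lo j≤ =
  outside ∷ t , ⊆-∷ p⊆t (λ e → e) , ⊆-∷ t⊆q (λ ()) , eq
... | no j≰ = inside ∷ q , ⊆-∷ (drop-∷-⊆ p⊆q) (λ ()) , (λ e → e) , ≤-antisym (≰⇒> j≰) hi

toSubset : ∀ {n} → List (Fin n) → Subset n
toSubset []       = ∅
toSubset (x ∷ xs) = toSubset xs ∪ ⁅ x ⁆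

∣toSubset∣≤ : ∀ {n} (xs : List (Fin n)) → ∣ toSubset xs ∣ ≤ length xs
∣toSubset∣≤ {n} [] = ≤-reflexive (∣⊥∣≡0 n)
∣toSubset∣≤ (x ∷ xs) = ≤-trans (∣p∪⁅x⁆∣≤ (toSubset xs) x) (s≤s (∣toSubset∣≤ xs))

toSubset⊆ : ∀ {n} {xs : List (Fin n)} {e} → All (_∈ e) xs → toSubset xs ⊆ e
toSubset⊆ [] x∈ = ⊥-elim (∉⊥ x∈)
toSubset⊆ {xs = x ∷ xs} {e} (px ∷ pxs) {y} y∈ with x∈p∪q⁻ (toSubset xs) ⁅ x ⁆ y∈
... | inj₁ y∈xs = toSubset⊆ pxs y∈xs
... | inj₂ y∈x  = subst (_∈ e) (sym (x∈⁅y⁆⇒x≡y x y∈x)) px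

⊆⇒All : ∀ {n} (xs : List (Fin n)) {t} → toSubset xs ⊆ t → All (_∈ t) xs
⊆⇒All []       _ = []
⊆⇒All (x ∷ xs) h = h (q⊆p∪q (toSubset xs) ⁅ x ⁆ (x∈⁅x⁆ x)) ∷ ⊆⇒All xs (h ∘ p⊆p∪q ⁅ x ⁆)

Unique-resp-↭ : ∀ {A : Set} {xs ys : List A} → xs ↭ ys → Unique xs → Unique ys
Unique-resp-↭ _↭_.refl uq = uq
Unique-resp-↭ (prep x p) (x∉ ∷ uq) = All-resp-↭ p x∉ ∷ Unique-resp-↭ p uq
Unique-resp-↭ (swap x y p) ((x≢y ∷ x∉) ∷ y∉ ∷ uq) = ((x≢y ∘ sym) ∷ All-resp-↭ p y∉) ∷ All-resp-↭ p x∉ ∷ Unique-resp-↭ p uq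
Unique-resp-↭ (_↭_.trans p q) uq = Unique-resp-↭ q (Unique-resp-↭ p uq)

module _ {n r : ℕ} (H : RGraph n r) where

  -- Without `Unique` the list x, x would be a face and violate `φ-edge`.
  Face : List (Fin n) → Set
  Face xs = Unique xs × ∃[ e ] (IsEdge H e × All (_∈ e) xs)

  face? : ∀ xs → Dec (Face xs)
  face? xs = allPairs? (λ x y → ¬? (x ≟ᶠ y)) xs ×-dec anySubset? (λ e → (edge H e ≟ᵇ true) ×-dec allᴸ? (_∈? e) xs)

  face : List (Fin n) → Bool
  face xs = does (face? xs)

  from-face : ∀ {xs} → face xs ≡ true → Face xs
  from-face {xs} = does-true (face? xs)

  to-face : ∀ {xs} → Face xs → face xs ≡ true
  to-face {xs} = dec-true (face? xs)

  vertex-face : NoIsolated H → ∀ x → face (x ∷ []) ≡ true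
  vertex-face covered x with e , He , x∈e ← covered x = to-face ([] ∷ [] , e , He , x∈e ∷ [])

  -- Inside an edge a short face is enlarged to a shadow set of r - 1 vertices; whatever extends
  -- that set extends the face.
  face-extend : ∀ {δ} → (∀ S → InShadow H S → δ ≤ codeg H S) →
    ∀ xs → face xs ≡ true → length xs < r → δ ≤ # (λ x → face (x ∷ xs))
  face-extend bound xs fx len with uq , e , He , xs∈e ← from-face fx
    with t , xs⊆t , t⊆e , ∣t∣ ← ⊆-interpolate (toSubset xs) e (r ∸ 1) (toSubset⊆ xs∈e)
           (≤-trans (∣toSubset∣≤ xs) (∸-monoˡ-≤ 1 len))
           (≤-trans (m∸n≤m r 1) (≤-reflexive (sym (uniform H e He)))) =
    ≤-trans (bound t (∣t∣ , e , He , t⊆e)) (≤-trans (≤-reflexive (∣tabulate∣ λ x → not (lookup t x) ∧ edge H (t ∪ ⁅ x ⁆)))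
      (#-mono {n} λ x h → to-face (fresh x (∧-elimˡ h) ∷ uq , t ∪ ⁅ x ⁆ , ∧-elimʳ {not (lookup t x)} h ,
        q⊆p∪q t ⁅ x ⁆ (x∈⁅x⁆ x) ∷ All.map (p⊆p∪q ⁅ x ⁆) xs∈t)))
    where
    xs∈t = ⊆⇒All xs xs⊆t
    fresh : ∀ x → not (lookup t x) ≡ true → All (x ≢_) xs
    fresh x x∉t = All.map (λ { y∈t refl → not-false x∉t ([]=⇒lookup y∈t) }) xs∈t

  module _ {k : ℕ} {φ ϑ : Fin n → Fin k} where

    open Complexes φ ϑ

    face-complex : IsColoring k H φ → IsColoring k H ϑ → NoIsolated H → Fin n →
      ∀ {δ} → (∀ S → InShadow H S → δ ≤ codeg H S) → Complex δ r k face
    face-complex colφ colϑ covered x bound = record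
      { empty  = to-face ([] , proj₁ (covered x) , proj₁ (proj₂ (covered x)) , [])
      ; perm   = λ p f → let uq , e , He , xs∈e = from-face f in to-face (Unique-resp-↭ p uq , e , He , All-resp-↭ p xs∈e)
      ; down   = down′ ∘ from-face
      ; extend = face-extend bound
      ; φ-edge = proper colφ ∘ from-face
      ; ϑ-edge = proper colϑ ∘ from-face
      ; rows   = allFin k , length-tabulate _ , (λ x _ → ∈-allFin (φ x))
      ; cols   = allFin k , length-tabulate _ , (λ x _ → ∈-allFin (ϑ x))
      }
      where
      down′ : ∀ {x xs} → Face (x ∷ xs) → face xs ≡ true
      down′ (_ ∷ uq , e , He , _ ∷ xs∈e) = to-face (uq , e , He , xs∈e)
      proper : ∀ {ψ : Fin n → Fin k} → IsColoring k H ψ → ∀ {x y} → Face (x ∷ y ∷ []) → ψ x ≢ ψ y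
      proper col ((x≢y ∷ []) ∷ _ , e , He , x∈e ∷ y∈e ∷ []) eq = x≢y (col e He _ _ x∈e y∈e eq)

-- Unique colourability from the bounds.

module _ {n r k : ℕ} (H : RGraph n r) (A B : ℕ) .{{_ : NonZero A}}
  (bound : ∀ (φ ϑ : Fin n → Fin k) u v (e : φ u ≡ φ v) (ne : ϑ u ≢ ϑ v) → Complexes.Conflict.Bound φ ϑ u v e ne A B r k)
  (covered : NoIsolated H) (large : ∀ S → InShadow H S → B * n < codeg H S * A) where

  same-kernel : ∀ {φ ϑ : Fin n → Fin k} → IsColoring k H φ → IsColoring k H ϑ → ∀ u v → φ u ≡ φ v → ϑ u ≡ ϑ v
  same-kernel {φ} {ϑ} colφ colϑ u v φu≡φv with ϑ u ≟ᶠ ϑ v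
  ... | yes eq = eq
  ... | no  ne = ⊥-elim (<⇒≱ above (begin
      A * δ                 ≤⟨ Complexes.Conflict.Bound.at (bound φ ϑ u v φu≡φv ne)
                                 (face-complex H colφ colϑ covered u (λ S sh → m<n*o⇒m/o<n (large S sh)))
                                 (vertex-face H covered u) (vertex-face H covered v) ⟩
      B * # (λ x → face H (x ∷ [])) ≤⟨ *-monoʳ-≤ B (#-≤ (λ x → face H (x ∷ []))) ⟩
      B * n                 ∎))
    where
    open ≤-Reasoning
    -- The least integer above B n / A, hence a lower bound for all positive codegrees.
    δ = suc (B * n div A)
    above : B * n < A * δ
    above = begin-strict
      B * n                        ≡⟨ m≡m%n+[m/n]*n (B * n) A ⟩
      (B * n) % A + B * n div A * A  <⟨ +-monoˡ-< (B * n div A * A) (m%n<n (B * n) A) ⟩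
      A + B * n div A * A            ≡⟨ *-comm δ A ⟩
      A * δ                        ∎

transpose-at : ∀ {k} (i j : Fin k) → swap-values i j i ≡ j
transpose-at i j rewrite dec-true (i ≟ᶠ i) refl = refl

transpose-off : ∀ {k} {i j l : Fin k} → l ≢ i → l ≢ j → swap-values i j l ≡ l
transpose-off {i = i} {j} {l} l≢i l≢j rewrite dec-false (l ≟ᶠ i) l≢i | dec-false (l ≟ᶠ j) l≢j = refl

-- The permutation is built vertex by vertex. If the first vertex has a colour not seen among the
-- later ones, a transposition corrects its image; it fixes the colours `ϑ` of the later vertices
-- because the kernels agree.
same-kernel⇒Equivalent : ∀ {n k} (φ ϑ : Fin n → Fin k) →
  (∀ u v → φ u ≡ φ v → ϑ u ≡ ϑ v) → (∀ u v → ϑ u ≡ ϑ v → φ u ≡ φ v) → Equivalent φ ϑ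
same-kernel⇒Equivalent {zero}  φ ϑ _ _ = idₚ , λ ()
same-kernel⇒Equivalent {suc n} {k} φ ϑ to from
  with η , agrees ← same-kernel⇒Equivalent (φ ∘ suc) (ϑ ∘ suc) (λ u v → to (suc u) (suc v)) (λ u v → from (suc u) (suc v)) 
  with any? (λ u → φ (suc u) ≟ᶠ φ zero)
... | yes (u , eq) = η , λ { zero → trans (to zero (suc u) (sym eq)) (trans (agrees u) (cong (η ⟨$⟩ʳ_) eq)) ; (suc v) → agrees v }
... | no  new = η ∘ₚ transpose (η ⟨$⟩ʳ φ zero) (ϑ zero) , λ
      { zero    → sym (transpose-at (η ⟨$⟩ʳ φ zero) (ϑ zero))
      ; (suc v) → trans (agrees v) (sym (transpose-off
          (λ eq → new (v , trans (sym (inverseˡ η)) (trans (cong (η ⟨$⟩ˡ_) eq) (inverseˡ η))))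
          (λ eq → new (v , from (suc v) zero (trans (agrees v) eq))))) }

uniquely-colorable : ∀ {n r k} (H : RGraph n r) A B → .{{NonZero A}} →
  (∀ (φ ϑ : Fin n → Fin k) u v (e : φ u ≡ φ v) (ne : ϑ u ≢ ϑ v) → Complexes.Conflict.Bound φ ϑ u v e ne A B r k) →
  Partite k H → NoIsolated H → (∀ S → InShadow H S → B * n < codeg H S * A) → UniquelyColorable k H
uniquely-colorable H A B bound partite covered large = partite , λ φ ϑ colφ colϑ →
  same-kernel⇒Equivalent φ ϑ (same-kernel H A B bound covered large colφ colϑ) (same-kernel H A B bound covered large colϑ colφ)

fraction-bound : ∀ {n r} (H : RGraph n r) q a d → q ≡ (pos a) / suc d → MinPosCodegGreater H (q *ℚ ℕ→ℚ n) →
  ∀ S → InShadow H S → a * n < codeg H S * suc d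
fraction-bound {n} H q a d refl codegrees S sh = scaled-< a d n (codeg H S) (codegrees S sh)

upper′ : ∀ {n} r d (H : RGraph n (suc r)) → Partite (suc r + d) H → NoIsolated H →
  MinPosCodegGreater H (c (suc r + d) (suc r) *ℚ ℕ→ℚ n) → UniquelyColorable (suc r + d) H
upper′ {n} r d H partite covered codegrees = [ high , low ]′ (c-range (suc r) d (s≤s z≤n))
  where
  high : 3 * d + 2 ≤ suc r × c (suc r + d) (suc r) ≡ pos (suc d) / suc (suc (suc r + d)) → _
  high (r≥ , c≡) = uniquely-colorable H (suc r + d + 2) (suc d) {{>-nonZero (s≤s z≤n)}}
    (λ φ ϑ u v e ne → proj₂ (proj₂ (Bounds.bounds φ ϑ u v e ne d)) (suc r) r≥) partite covered
    (λ S sh → subst (λ A → suc d * n < codeg H S * A) (+-comm 2 (suc r + d))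
      (fraction-bound H (c (suc r + d) (suc r)) (suc d) (suc (suc r + d)) c≡ codegrees S sh))
  denominator : suc (3 * (suc r + d) ∸ 3) ≡ 3 * r + 3 * d + 1
  denominator = trans (cong (λ s → suc (s ∸ 3)) (expand r d)) (+-comm 1 (3 * r + 3 * d))
    where
    expand : ∀ r d → 3 * (suc r + d) ≡ 3 + (3 * r + 3 * d)
    expand = solve-∀
  low : suc r ≤ 3 * d + 2 × c (suc r + d) (suc r) ≡ (pos (3 * d + 1)) / suc (3 * (suc r + d) ∸ 3) → _
  low (r≤ , c≡) = uniquely-colorable H (3 * r + 3 * d + 1) (3 * d + 1) {{>-nonZero (m≤n+m 1 (3 * r + 3 * d))}}
    (λ φ ϑ u v e ne → proj₁ (Bounds.bounds φ ϑ u v e ne d) r r≤) partite covered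
    (λ S sh → subst (λ A → (3 * d + 1) * n < codeg H S * A) denominator
      (fraction-bound H (c (suc r + d) (suc r)) (3 * d + 1) (3 * (suc r + d) ∸ 3) c≡ codegrees S sh))

upper : ∀ (n k r : ℕ) → 2 ≤ r → r ≤ k → k ≤ n → (H : RGraph n r) →
  Partite k H → NoIsolated H → MinPosCodegGreater H (c k r *ℚ ℕ→ℚ n) → UniquelyColorable k H
upper n k (suc r) _ r≤k _ H = subst
  (λ k → Partite k H → NoIsolated H → MinPosCodegGreater H (c k (suc r) *ℚ ℕ→ℚ n) → UniquelyColorable k H)
  (m+[n∸m]≡n r≤k) (upper′ r (k ∸ suc r) H)

-- Sharpness: the r-graph of sets rainbow in two colourings.

#-none : ∀ {n} {q : Fin n → Bool} → (∀ i → q i ≢ true) → # q ≡ 0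
#-none {zero} h = refl
#-none {suc n} {q} h with q zero in eq
... | true  = ⊥-elim (h zero eq)
... | false = #-none (h ∘ suc)

#-union : ∀ {m n} (S : Subset m) (R : Fin m → Fin n → Bool) t (q : Fin n → Bool) → (∀ s → # (R s) ≤ t) →
  (∀ v → q v ≡ true → ∃[ s ] (s ∈ S × R s v ≡ true)) → # q ≤ ∣ S ∣ * t
#-union [] R t q small cov = ≤-reflexive (#-none λ v qv → no-index (cov v qv))
  where
  no-index : ∀ {P : Fin 0 → Set} → ¬ (∃[ s ] P s)
  no-index (() , _)
#-union {n = n} (inside ∷ S) R t q small cov = ≤-trans
  (#-cover {n} {λ v → q v ∧ not (R zero v)} {R zero} λ v qv no → ∧-intro qv (not-intro no))
  (≤-trans (+-mono-≤ (#-union S (R ∘ suc) t (λ v → q v ∧ not (R zero v)) (small ∘ suc) cov′) (small zero))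
    (≤-reflexive (+-comm (∣ S ∣ * t) t)))
  where
  cov′ : ∀ v → (q v ∧ not (R zero v)) ≡ true → ∃[ s ] (s ∈ S × R (suc s) v ≡ true)
  cov′ v e with cov v (∧-elimˡ e)
  ... | zero  , _         , r = ⊥-elim (not-false (∧-elimʳ {q v} e) r)
  ... | suc s , there s∈S , r = s , s∈S , r
#-union (outside ∷ S) R t q small cov = #-union S (R ∘ suc) t q (small ∘ suc) cov′
  where
  cov′ : ∀ v → q v ≡ true → ∃[ s ] (s ∈ S × R (suc s) v ≡ true)
  cov′ v qv with suc s , there s∈S , r ← cov v qv = s , s∈S , r

#-lookup : ∀ {n} (S : Subset n) → # (lookup S) ≡ ∣ S ∣
#-lookup []            = refl
#-lookup (inside  ∷ S) = cong suc (#-lookup S)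
#-lookup (outside ∷ S) = #-lookup S

∣p∪⁅x⁆∣≡ : ∀ {n} (p : Subset n) x → x ∉ p → ∣ p ∪ ⁅ x ⁆ ∣ ≡ suc ∣ p ∣
∣p∪⁅x⁆∣≡ (inside  ∷ p) zero    x∉p = ⊥-elim (x∉p here)
∣p∪⁅x⁆∣≡ (outside ∷ p) zero    x∉p = cong (suc ∘ ∣_∣) (∪-identityʳ p)
∣p∪⁅x⁆∣≡ (inside  ∷ p) (suc x) x∉p = cong suc (∣p∪⁅x⁆∣≡ p x (x∉p ∘ there))
∣p∪⁅x⁆∣≡ (outside ∷ p) (suc x) x∉p = ∣p∪⁅x⁆∣≡ p x (x∉p ∘ there)

module Rainbows {n k : ℕ} (φ ϑ : Fin n → Fin k) where

  Clash : Fin n → Fin n → Set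
  Clash x y = φ x ≡ φ y ⊎ ϑ x ≡ ϑ y

  clash? : ∀ x y → Dec (Clash x y)
  clash? x y = (φ x ≟ᶠ φ y) ⊎-dec (ϑ x ≟ᶠ ϑ y)

  Clash-sym : ∀ {x y} → Clash x y → Clash y x
  Clash-sym (inj₁ e) = inj₁ (sym e)
  Clash-sym (inj₂ e) = inj₂ (sym e)

  -- These are the cliques of the graph that joins vertices differing in both colours.
  Rainbow : Subset n → Set
  Rainbow S = ∀ x → x ∈ S → ∀ y → y ∈ S → Clash x y → x ≡ y

  rainbow? : ∀ S → Dec (Rainbow S)
  rainbow? S = all? λ x → (x ∈? S) →-dec (all? λ y → (y ∈? S) →-dec (clash? x y →-dec (x ≟ᶠ y)))

  -- A member of `S` clashes with itself and so is blocked; an unblocked vertex is automatically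
  -- new.
  Blocked : Subset n → Fin n → Set
  Blocked S y = ∃[ x ] (x ∈ S × Clash x y)

  blocked? : ∀ S y → Dec (Blocked S y)
  blocked? S y = any? λ x → (x ∈? S) ×-dec clash? x y

  blocked : Subset n → Fin n → Bool
  blocked S y = does (blocked? S y)

  unblocked-∉ : ∀ {S y} → ¬ Blocked S y → y ∉ S
  unblocked-∉ free y∈S = free (_ , y∈S , inj₁ refl)

  Rainbow-∪ : ∀ {S y} → Rainbow S → ¬ Blocked S y → Rainbow (S ∪ ⁅ y ⁆)
  Rainbow-∪ {S} {y} rain free a a∈ b b∈ clash with x∈p∪q⁻ S ⁅ y ⁆ a∈ | x∈p∪q⁻ S ⁅ y ⁆ b∈
  ... | inj₁ a∈S | inj₁ b∈S = rain a a∈S b b∈S clash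
  ... | inj₁ a∈S | inj₂ b∈y rewrite x∈⁅y⁆⇒x≡y y b∈y = ⊥-elim (free (a , a∈S , clash))
  ... | inj₂ a∈y | inj₁ b∈S rewrite x∈⁅y⁆⇒x≡y y a∈y = ⊥-elim (free (b , b∈S , Clash-sym clash))
  ... | inj₂ a∈y | inj₂ b∈y = trans (x∈⁅y⁆⇒x≡y y a∈y) (sym (x∈⁅y⁆⇒x≡y y b∈y))

  Rainbow-⁅⁆ : ∀ x → Rainbow ⁅ x ⁆
  Rainbow-⁅⁆ x y y∈ z z∈ _ = trans (x∈⁅y⁆⇒x≡y x y∈) (sym (x∈⁅y⁆⇒x≡y x z∈))

  module _ (r : ℕ) where

    rainbow-graph : RGraph n r
    rainbow-graph = record
      { edge    = λ e → does (∣ e ∣ ≟ⁿ r) ∧ does (rainbow? e)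
      ; uniform = λ e He → does-true (∣ e ∣ ≟ⁿ r) (∧-elimˡ He)
      }

    edge⇒Rainbow : ∀ {e} → IsEdge rainbow-graph e → Rainbow e
    edge⇒Rainbow {e} He = does-true (rainbow? e) (∧-elimʳ {does (∣ e ∣ ≟ⁿ r)} He)

    Rainbow⇒edge : ∀ {e} → ∣ e ∣ ≡ r → Rainbow e → IsEdge rainbow-graph e
    Rainbow⇒edge {e} size rain = ∧-intro (dec-true (∣ e ∣ ≟ⁿ r) size) (dec-true (rainbow? e) rain)

    module _ (a : ℕ) (0<a : 0 < a) (free : ∀ S → Rainbow S → ∣ S ∣ < r → a + # (blocked S) ≤ n) where

      unblocked : ∀ S → Rainbow S → ∣ S ∣ < r → a ≤ # (not ∘ blocked S)
      unblocked S rain small = +-cancelʳ-≤ (# (blocked S)) a _ (≤-trans (free S rain small)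
        (≤-trans (≤-reflexive (sym #-all)) (#-cover {n} λ y _ no → not-intro no)))

      -- The counting hypothesis `free` concerns every rainbow set below size `r`, not only those of
      -- size r - 1, so even a single vertex grows to an edge.
      enlarge : ∀ j S → Rainbow S → ∣ S ∣ + j ≡ r → ∃[ e ] (IsEdge rainbow-graph e × S ⊆ e)
      enlarge zero    S rain size = S , Rainbow⇒edge (trans (sym (+-identityʳ _)) size) rain , (λ x∈ → x∈)
      enlarge (suc j) S rain size
        with y , uy ← #-inhabited (not ∘ blocked S) (≤-trans 0<a (unblocked S rain (m+n≤o⇒m≤o (suc ∣ S ∣) (≤-reflexive (trans (sym (+-suc ∣ S ∣ j)) size)))))
        = let open-y : ¬ Blocked S y
              open-y b = not-false uy (dec-true (blocked? S y) b)
              e , He , S∪y⊆e = enlarge j (S ∪ ⁅ y ⁆) (Rainbow-∪ rain open-y)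
                (trans (cong (_+ j) (∣p∪⁅x⁆∣≡ S y (unblocked-∉ open-y))) (trans (sym (+-suc ∣ S ∣ j)) size))
          in e , He , S∪y⊆e ∘ p⊆p∪q ⁅ y ⁆

      covered : 1 ≤ r → NoIsolated rainbow-graph
      covered 1≤r x with e , He , x⊆e ← enlarge (r ∸ 1) ⁅ x ⁆ (Rainbow-⁅⁆ x) (trans (cong (_+ (r ∸ 1)) (∣⁅x⁆∣≡1 x)) (m+[n∸m]≡n 1≤r)) =
        e , He , x⊆e (x∈⁅x⁆ x)

      codegree : 1 ≤ r → ∀ S → InShadow rainbow-graph S → a ≤ codeg rainbow-graph S
      codegree 1≤r S (size , e , He , S⊆e) = ≤-trans (unblocked S rain small)
        (≤-trans (#-mono {n} available) (≤-reflexive (sym (∣tabulate∣ λ y → not (lookup S y) ∧ edge rainbow-graph (S ∪ ⁅ y ⁆)))))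
        where
        rain : Rainbow S
        rain x x∈ y y∈ = edge⇒Rainbow He x (S⊆e x∈) y (S⊆e y∈)
        suc-size : suc ∣ S ∣ ≡ r
        suc-size = trans (cong suc size) (m+[n∸m]≡n 1≤r)
        small : ∣ S ∣ < r
        small = ≤-reflexive suc-size
        available : ∀ y → not (blocked S y) ≡ true → (not (lookup S y) ∧ edge rainbow-graph (S ∪ ⁅ y ⁆)) ≡ true
        available y uy = ∧-intro (not-intro λ e → y∉S (lookup⇒[]= y S e))
          (Rainbow⇒edge (trans (∣p∪⁅x⁆∣≡ S y y∉S) suc-size) (Rainbow-∪ rain open-y))
          where
          open-y : ¬ Blocked S y
          open-y b = not-false uy (dec-true (blocked? S y) b)
          y∉S = unblocked-∉ open-y

    φ-colouring : IsColoring k rainbow-graph φ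
    φ-colouring e He x y x∈ y∈ eq = edge⇒Rainbow He x x∈ y y∈ (inj₁ eq)

    ϑ-colouring : IsColoring k rainbow-graph ϑ
    ϑ-colouring e He x y x∈ y∈ eq = edge⇒Rainbow He x x∈ y y∈ (inj₂ eq)

    not-unique : ∀ u v → φ u ≡ φ v → ϑ u ≢ ϑ v → ¬ UniquelyColorable k rainbow-graph
    not-unique u v φu≡φv ϑu≢ϑv (_ , equivalent) with η , agrees ← equivalent φ ϑ φ-colouring ϑ-colouring =
      ϑu≢ϑv (trans (agrees u) (trans (cong (η ⟨$⟩ʳ_) φu≡φv) (sym (agrees v))))

Sharp : ℚ → (k r : ℕ) → Set
Sharp x k r = ∃[ n ] (k ≤ n × Σ (RGraph n r) (λ H →
  Partite k H × NoIsolated H × MinPosCodegGreater H (x *ℚ ℕ→ℚ n) × ¬ UniquelyColorable k H))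

-- The four special vertices have colour pairs (0,0), (1,1), (0,1), (1,0), so 0F1F and 2F3F are the only compatible pairs
-- among them; the other vertices have the same colour in both colourings.
module Example {m w : ℕ} (part : Fin w → Fin m) where

  φ ϑ : Fin (4 + w) → Fin (2 + m)
  φ 0F = 0F
  φ 1F = 1F
  φ 2F = 0F
  φ 3F = 1F
  φ (suc (suc (suc (suc x)))) = suc (suc (part x))
  ϑ 0F = 0F
  ϑ 1F = 1F
  ϑ 2F = 1F
  ϑ 3F = 0F
  ϑ (suc (suc (suc (suc x)))) = suc (suc (part x))

  open Rainbows φ ϑ public

  example : ∀ x r a → 1 ≤ r → 0 < a → m ≤ w → (∀ S → Rainbow S → ∣ S ∣ < r → a + # (blocked S) ≤ 4 + w) →
    x <ℚ (pos a) / (4 + w) → Sharp x (2 + m) r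
  example x r a 1≤r 0<a m≤w free x< = 4 + w , +-mono-≤ (s≤s (s≤s (z≤n {2}))) m≤w , rainbow-graph r ,
    (φ , φ-colouring r) , covered r a 0<a free 1≤r ,
    (λ S sh → below-fraction a (3 + w) (codeg (rainbow-graph r) S) x x< (codegree r a 0<a free 1≤r S sh)) ,
    not-unique r 0F 2F refl (λ ())

block : ∀ m → Fin (m * 3) → Fin m
block (suc m) 0F = zero
block (suc m) 1F = zero
block (suc m) 2F = zero
block (suc m) (suc (suc (suc x))) = suc (block m x)

#-block : ∀ m i → # (λ x → does (i ≟ᶠ block m x)) ≤ 3
#-block (suc m) zero    = ≤-reflexive (cong (3 +_) (#-none {m * 3} λ _ ()))
#-block (suc m) (suc i) = #-block m i

module Weighted (m : ℕ) where

  open Example (block m) public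

  -- A special vertex clashes with itself and both ends of the other special edge. Ordinary classes
  -- of three vertices match this number.
  clash-count : ∀ x → # (λ y → does (clash? x y)) ≤ 3
  clash-count 0F = ≤-reflexive (cong (3 +_) (#-none {m * 3} λ _ ()))
  clash-count 1F = ≤-reflexive (cong (3 +_) (#-none {m * 3} λ _ ()))
  clash-count 2F = ≤-reflexive (cong (3 +_) (#-none {m * 3} λ _ ()))
  clash-count 3F = ≤-reflexive (cong (3 +_) (#-none {m * 3} λ _ ()))
  clash-count (suc (suc (suc (suc x)))) = ≤-trans
    (#-mono {m * 3} {q = λ y → does (block m x ≟ᶠ block m y)} λ y e → trans (sym (∨-idem _)) e) (#-block m (block m x))

  blocked-count : ∀ S → # (blocked S) ≤ ∣ S ∣ * 3
  blocked-count S = #-union S (λ x y → does (clash? x y)) 3 (blocked S) clash-count λ y b →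
    let x , x∈S , clash = does-true (blocked? S y) b in x , x∈S , dec-true (clash? x y) clash

  -- There are 4 + 3 (k - 2) = 3 k - 2 vertices, of which at most `r` members of a rainbow set block
  -- 3 r, leaving 3 d + 1.
  low-example : ∀ r d → 2 + m ≡ suc r + d → ∀ x → x <ℚ (pos (3 * d + 1)) / (4 + m * 3) → Sharp x (2 + m) (suc r)
  low-example r d k≡ x = example x (suc r) (3 * d + 1) (s≤s z≤n) (m≤n+m 1 (3 * d)) (m≤m*n m 3) λ S _ small → begin
    3 * d + 1 + # (blocked S)  ≤⟨ +-monoʳ-≤ (3 * d + 1) (blocked-count S) ⟩
    3 * d + 1 + ∣ S ∣ * 3      ≤⟨ +-monoʳ-≤ (3 * d + 1) (*-monoˡ-≤ 3 (≤-pred small)) ⟩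
    3 * d + 1 + r * 3          ≡⟨ total ⟩
    4 + m * 3                  ∎
    where
    open ≤-Reasoning
    expand : ∀ d r → 2 + (3 * d + 1 + r * 3) ≡ (suc r + d) * 3
    expand = solve-∀
    total : 3 * d + 1 + r * 3 ≡ 4 + m * 3
    total = +-cancelˡ-≡ 2 _ _ (trans (expand d r) (cong (_* 3) (sym k≡)))

module Unweighted (m : ℕ) where

  open Example {m} (λ x → x) public

  front back : Fin (4 + m) → Bool
  front 0F = true
  front 1F = true
  front _  = false
  back 2F = true
  back 3F = true
  back _  = false

  clash-cases : ∀ x y → Clash x y →
    x ≡ y ⊎ (front x ≡ true × back y ≡ true) ⊎ (back x ≡ true × front y ≡ true)
  clash-cases 0F 0F _ = inj₁ refl
  clash-cases 0F 1F (inj₁ ())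
  clash-cases 0F 1F (inj₂ ())
  clash-cases 0F 2F _ = inj₂ (inj₁ (refl , refl))
  clash-cases 0F 3F _ = inj₂ (inj₁ (refl , refl))
  clash-cases 0F (suc (suc (suc (suc y)))) (inj₁ ())
  clash-cases 0F (suc (suc (suc (suc y)))) (inj₂ ())
  clash-cases 1F 0F (inj₁ ())
  clash-cases 1F 0F (inj₂ ())
  clash-cases 1F 1F _ = inj₁ refl
  clash-cases 1F 2F _ = inj₂ (inj₁ (refl , refl))
  clash-cases 1F 3F _ = inj₂ (inj₁ (refl , refl))
  clash-cases 1F (suc (suc (suc (suc y)))) (inj₁ ())
  clash-cases 1F (suc (suc (suc (suc y)))) (inj₂ ())
  clash-cases 2F 0F _ = inj₂ (inj₂ (refl , refl))
  clash-cases 2F 1F _ = inj₂ (inj₂ (refl , refl))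
  clash-cases 2F 2F _ = inj₁ refl
  clash-cases 2F 3F (inj₁ ())
  clash-cases 2F 3F (inj₂ ())
  clash-cases 2F (suc (suc (suc (suc y)))) (inj₁ ())
  clash-cases 2F (suc (suc (suc (suc y)))) (inj₂ ())
  clash-cases 3F 0F _ = inj₂ (inj₂ (refl , refl))
  clash-cases 3F 1F _ = inj₂ (inj₂ (refl , refl))
  clash-cases 3F 2F (inj₁ ())
  clash-cases 3F 2F (inj₂ ())
  clash-cases 3F 3F _ = inj₁ refl
  clash-cases 3F (suc (suc (suc (suc y)))) (inj₁ ())
  clash-cases 3F (suc (suc (suc (suc y)))) (inj₂ ())
  clash-cases (suc (suc (suc (suc x)))) 0F (inj₁ ())
  clash-cases (suc (suc (suc (suc x)))) 0F (inj₂ ())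
  clash-cases (suc (suc (suc (suc x)))) 1F (inj₁ ())
  clash-cases (suc (suc (suc (suc x)))) 1F (inj₂ ())
  clash-cases (suc (suc (suc (suc x)))) 2F (inj₁ ())
  clash-cases (suc (suc (suc (suc x)))) 2F (inj₂ ())
  clash-cases (suc (suc (suc (suc x)))) 3F (inj₁ ())
  clash-cases (suc (suc (suc (suc x)))) 3F (inj₂ ())
  clash-cases (suc (suc (suc (suc x)))) (suc (suc (suc (suc y)))) (inj₁ refl) = inj₁ refl
  clash-cases (suc (suc (suc (suc x)))) (suc (suc (suc (suc y)))) (inj₂ refl) = inj₁ refl

  back-0 : ∀ x → back x ≡ true → Clash x 0F
  back-0 2F _ = inj₁ refl
  back-0 3F _ = inj₂ refl

  back-1 : ∀ x → back x ≡ true → Clash x 1F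
  back-1 2F _ = inj₂ refl
  back-1 3F _ = inj₁ refl

  -- An ordinary vertex blocks only itself. The special vertices in a rainbow set belong to one
  -- special edge, so outside `S` only the two ends of the other one can be blocked.
  blocked-count : ∀ S → Rainbow S → # (blocked S) ≤ 2 + ∣ S ∣
  blocked-count S rain = count ((0F ∈? S) ⊎-dec (1F ∈? S))
    where
    from-pair : (pair : Fin (4 + m) → Bool) → # pair ≡ 2 → (∀ x y → x ∈ S → Clash x y → y ∉ S → pair y ≡ true) →
      # (blocked S) ≤ 2 + ∣ S ∣
    from-pair pair two h = ≤-trans
      (#-cover {4 + m} {pair} {lookup S} λ y b y∉S → let x , x∈S , clash = does-true (blocked? S y) b in
        h x y x∈S clash (λ y∈S → y∉S ([]=⇒lookup y∈S)))
      (≤-reflexive (cong₂ _+_ two (#-lookup S)))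
    in-back : 0F ∈ S ⊎ 1F ∈ S → ∀ x y → x ∈ S → Clash x y → y ∉ S → back y ≡ true
    in-back some x y x∈S clash y∉S with clash-cases x y clash
    ... | inj₁ refl = ⊥-elim (y∉S x∈S)
    ... | inj₂ (inj₁ (_ , y-back)) = y-back
    in-back (inj₁ 0∈S) x y x∈S _ _ | inj₂ (inj₂ (x-back , _)) with refl ← rain x x∈S 0F 0∈S (back-0 x x-back) with () ← x-back
    in-back (inj₂ 1∈S) x y x∈S _ _ | inj₂ (inj₂ (x-back , _)) with refl ← rain x x∈S 1F 1∈S (back-1 x x-back) with () ← x-back
    in-front : ¬ (0F ∈ S ⊎ 1F ∈ S) → ∀ x y → x ∈ S → Clash x y → y ∉ S → front y ≡ true
    in-front none x y x∈S clash y∉S with clash-cases x y clash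
    ... | inj₁ refl = ⊥-elim (y∉S x∈S)
    ... | inj₂ (inj₂ (_ , y-front)) = y-front
    in-front none 0F y x∈S _ _ | inj₂ (inj₁ _) = ⊥-elim (none (inj₁ x∈S))
    in-front none 1F y x∈S _ _ | inj₂ (inj₁ _) = ⊥-elim (none (inj₂ x∈S))
    count : Dec (0F ∈ S ⊎ 1F ∈ S) → # (blocked S) ≤ 2 + ∣ S ∣
    count (yes some) = from-pair back  (cong (2 +_) (#-none {m} λ _ ())) (in-back some)
    count (no  none) = from-pair front (cong (2 +_) (#-none {m} λ _ ())) (in-front none)

  high-example : ∀ r d → 2 + m ≡ suc r + d → ∀ x → x <ℚ pos (suc d) / (4 + m) → Sharp x (2 + m) (suc r)
  high-example r d k≡ x = example x (suc r) (suc d) (s≤s z≤n) (s≤s z≤n) ≤-refl λ S rain small → begin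
    suc d + # (blocked S)    ≤⟨ +-monoʳ-≤ (suc d) (blocked-count S rain) ⟩
    suc d + (2 + ∣ S ∣)      ≤⟨ +-monoʳ-≤ (suc d) (+-monoʳ-≤ 2 (≤-pred small)) ⟩
    suc d + (2 + r)          ≡⟨ collect d r ⟩
    2 + (suc r + d)          ≡⟨ cong (2 +_) k≡ ⟨
    4 + m                    ∎
    where
    open ≤-Reasoning
    collect : ∀ d r → suc d + (2 + r) ≡ 2 + (suc r + d)
    collect = solve-∀

lower′ : ∀ r d x → x <ℚ c (2 + r + d) (2 + r) → Sharp x (2 + r + d) (2 + r)
lower′ r d x x<c = [ high , low ]′ (c-range (2 + r) d (s≤s z≤n))
  where
  high : 3 * d + 2 ≤ 2 + r × c (2 + r + d) (2 + r) ≡ pos (suc d) / suc (suc (2 + r + d)) → _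
  high (_ , c≡) = Unweighted.high-example (r + d) (suc r) d refl x (subst (x <ℚ_) c≡ x<c)
  denominator : ∀ m → 3 * (2 + m) ∸ 3 ≡ 3 + m * 3
  denominator m = cong (_∸ 3) (*-comm 3 (2 + m))
  low : 2 + r ≤ 3 * d + 2 × c (2 + r + d) (2 + r) ≡ (pos (3 * d + 1)) / suc (3 * (2 + r + d) ∸ 3) → _
  low (_ , c≡) = Weighted.low-example (r + d) (suc r) d refl x
    (subst (x <ℚ_) (trans c≡ (cong (λ s → (pos (3 * d + 1)) / suc s) (denominator (r + d)))) x<c)

lower : ∀ (k r : ℕ) → 2 ≤ r → r ≤ k → (x : ℚ) → x <ℚ c k r → Sharp x k r
lower k (suc (suc r)) _ r≤k x = subst (λ k → x <ℚ c k (2 + r) → Sharp x k (2 + r)) (m+[n∸m]≡n r≤k) (lower′ r (k ∸ (2 + r)) x)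
lower k (suc zero) (s≤s ())

theorem1p2 : (∀ (n k r : ℕ) → 2 ≤ r → r ≤ k → k ≤ n → (H : RGraph n r) →
    Partite k H → NoIsolated H → MinPosCodegGreater H (c k r *ℚ ℕ→ℚ n) →
    UniquelyColorable k H)
    ×
    (∀ (k r : ℕ) → 2 ≤ r → r ≤ k → (x : ℚ) → x <ℚ c k r →
    ∃[ n ] (k ≤ n × Σ (RGraph n r) (λ H →
    Partite k H × NoIsolated H × MinPosCodegGreater H (x *ℚ ℕ→ℚ n) × ¬ UniquelyColorable k H)))
theorem1p2 = upper , lower
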